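{- Let $(\mathbb{T},\log,\partial,\circ,x)$, with $\mathbb{T}=\mathbf{R}[[\mathfrak{N}]]$, be a structure satisfying conditions (i)–(viii) of the context, and assume that any two $f,g\in\mathbb{T}^{>\mathbf{R}}$ with $f,g>x$ are conjugate in the group $(\mathbb{T}^{>\mathbf{R}},\circ,x)$. Then for all $f\in\mathbb{T}^{>\mathbf{R}}$ with $f\neq x$, there is an isomorphism of ordered groups $(\mathcal{C}(f),\circ,x,<)\simeq(\mathbf{R},+,0,<)$, where $\mathcal{C}(f)=\{h\in\mathbb{T}^{>\mathbf{R}}:h\circ f=f\circ h\}$.
   Context: Well-based series. The set theory is NBG; groups and fields may be proper classes. For an ordered field $\mathbf{R}$ and a linearly ordered abelian group $(\mathfrak{N},\cdot,1,\prec)$, $\mathbf{R}[[\mathfrak{N}]]$ is the ordered field of functions $s:\mathfrak{N}\to\mathbf{R}$ whose support $\operatorname{supp}s$ is a set well-ordered for $\succ$, with pointwise sum and Cauchy product; $s>0$ iff $s\neq0$ and $s(\max\operatorname{supp}s)>0$. Monomials (elements of $\mathfrak{N}$) and elements of $\mathbf{R}$ are identified with series. For $s\neq0$, $\mathfrak{d}(s)=\max\operatorname{supp}s$. $s\prec t$ means $r|s|<|t|$ for all $r\in\mathbf{R}^{>}$; $s\preccurlyeq t$ means not $t\prec s$. $\mathbb{T}_{\succ}=\{s:\operatorname{supp}s\succ1\}$ and $\mathbb{T}^{>\mathbf{R}}=\mathbb{T}^{>,\succ}=\{s:s>\mathbf{R}\}$. A family $(s_i)$ is summable if $\bigcup_i\operatorname{supp}s_i$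 is a set well-ordered by $\succ$ and each monomial lies in finitely many $\operatorname{supp}s_i$; an $\mathbf{R}$-linear map is strongly linear if it preserves summability and commutes with sums of summable families. When $\log$ is given, for $s,t\in\mathbb{T}^\times$: $s\prec\!\!\prec t$ iff $\log|s|\prec\log|t|$; $s\preccurlyeq\!\!\preccurlyeq t$ iff $\log|s|\preccurlyeq\log|t|$. Write $f'=\partial(f)$, $f^{(k)}=\partial^k(f)$. Conditions. (i) $\mathfrak{N}$ is a linearly ordered abelian group, $\mathbf{R}$ an ordered field, $\mathbb{T}=\mathbf{R}[[\mathfrak{N}]]$. (ii) $(\mathbb{T},\log)$ is an exponentially closed transserial field: $\log:(\mathbb{T}^{>},\cdot,1,<)\to(\mathbb{T},+,0,<)$ is an isomorphism of ordered groups, $\log\mathfrak{N}\subseteq\mathbb{T}_{\succ}$, $\log s\leqslant s-1$ for $s\in\mathbb{T}^{>}$, $\log(1+\varepsilon)=\sum_{k>0}\frac{(-1)^{k+1}}{k}\varepsilon^k$ for $\varepsilon\prec1$, and $\log$ restricts to an isomorphism $(\mathbf{R}^{>},\cdot,<)\to(\mathbf{R},+,<)$. (iii) $\partial:\mathbb{T}\to\mathbb{T}$ is a surjective transserial derivation (strongly linear, Leibniz rule, $\partial(\log|s|)=\partial(s)/s$ for $s\neq0$), with identity $x\in\mathfrak{N}$ ($x>0$, $x \neq 1$, $\partial(x)=1$), which is flat: for $\mathfrak{m}\in\mathfrak{N}$ and $\mathfrak{n}\in\operatorname{supp}\partial(\mathfrak{m})$ there are $\mathfrak{f},\mathfrak{w}\in\mathfrak{N}$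 with $\mathfrak{f}\prec\!\!\prec\mathfrak{m}$, $\mathfrak{w}\preccurlyeq\!\!\preccurlyeq x$, $\mathfrak{n}=\mathfrak{m}\mathfrak{f}\mathfrak{w}$. (iv) $(\mathbb{T},\partial)$ is an H-field: $\ker\partial=\mathbf{R}$ and $f'>0$ for $f\in\mathbb{T}^{>,\succ}$. (v) $\circ:\mathbb{T}\times\mathbb{T}^{>,\succ}\to\mathbb{T}$ is a transserial composition law (each $f\mapsto f\circ s$ is a strongly linear morphism of ordered rings commuting with $\log$, and $f\circ(s\circ t)=(f\circ s)\circ t$) with identity $x$ ($x\circ s=s$, $f\circ x=f$), which is flat: for $s\in\mathbb{T}^{>,\succ}$, $\mathfrak{m}\in\mathfrak{N}\setminus\{1\}$, $\mathfrak{n}\in\operatorname{supp}(\mathfrak{m}\circ s)$ there are $\mathfrak{f},\mathfrak{w}\in\mathfrak{N}$, $\mathfrak{u}\in\operatorname{supp}s$ with $\mathfrak{f}\prec\!\!\prec\mathfrak{m}$, $\mathfrak{w}\preccurlyeq1$, $\mathfrak{w}\preccurlyeq\!\!\preccurlyeq\mathfrak{u}$, $\mathfrak{n}=\mathfrak{d}(\mathfrak{m}\circ s)\mathfrak{f}\mathfrak{w}$. (vi) Chain rule $(f\circ s)'=s'(f'\circ s)$; and Taylor expansions: whenever $s\in\mathbb{T}^{>,\succ}$, $\delta\prec s$, and $(\mathfrak{m}'\circ s)\delta\prec\mathfrak{m}\circ s$ for all $\mathfrak{m}\in\operatorname{supp}f$, the family $((\mathfrak{m}^{(k)}\circ s)\delta^k)_{\mathfrak{m}\in\operatorname{supp}f,k\in\mathbb{N}}$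 is summable, $f\circ(s+\delta)=\sum_k\frac{f^{(k)}\circ s}{k!}\delta^k=\sum_{\mathfrak{m},k}f(\mathfrak{m})\frac{\mathfrak{m}^{(k)}\circ s}{k!}\delta^k$, and $(f^{(k)}\circ s)\delta^k\succ(f^{(k+1)}\circ s)\delta^{k+1}$ whenever the left side is nonzero. (vii) $(\mathbb{T}^{>,\succ},\circ,x)$ is a group. (viii) Monotonicity: for $f\in\mathbb{T}\setminus\mathbf{R}$, the map $s\mapsto f\circ s$ on $\mathbb{T}^{>,\succ}$ is strictly increasing if $f'>0$ and strictly decreasing if $f'<0$. Under these conditions $(\mathbb{T}^{>\mathbf{R}},\circ,x,<)$ is a linearly bi-ordered group. Elements $f,g$ are conjugate if $h\circ f=g\circ h$ for some $h\in\mathbb{T}^{>\mathbf{R}}$. -}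

module Defs where

open import Algebra.Bundles using (Group; AbelianGroup; CommutativeRing)
open import Algebra.Bundles.Raw using (RawMagma; RawGroup)
open import Algebra.Core using (Op₁; Op₂)
open import Algebra.Morphism.Structures using (module MagmaMorphisms; module GroupMorphisms)
open import Algebra.Structures using (IsAbelianGroup; IsCommutativeRing; IsGroup)
import Algebra.Properties.Ring as RingProperties
open import Axiom.ExcludedMiddle using (ExcludedMiddle)
open import Data.Empty using (⊥; ⊥-elim)
open import Data.List.Base using (List; []; _∷_; foldr)
open import Data.List.Relation.Unary.All as All using (All; []; _∷_)
open import Data.List.Relation.Unary.All.Properties.Core using (All¬⇒¬Any; ¬Any⇒All¬)
open import Data.List.Relation.Unary.AllPairs using ([]; _∷_)
open import Data.List.Relation.Unary.Any using (here; there; _─_)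
import Data.List.Membership.Setoid as Membership
open import Data.List.Membership.Setoid.Properties using (∈-resp-≈)
import Data.List.Relation.Unary.Unique.Setoid as Unique
open import Data.Nat.Base using (ℕ; zero; suc)
open import Data.Product using (Σ; ∃; _×_; _,_; proj₁; proj₂)
open import Data.Product.Relation.Binary.Pointwise.NonDependent using (×-setoid)
import Data.Sum.Base as Sum
open import Data.Sum.Base using (_⊎_; inj₁; inj₂)
open import Data.Unit.Base using (⊤)
open import Function.Base using (_∘_; _on_)
open import Function.Bundles using (_⇔_)
open import Induction.WellFounded using (WellFounded; Acc; acc)
open import Level using (Level; Lift; _⊔_) renaming (suc to lsuc)
open import Relation.Binary.Bundles using (Setoid)
open import Relation.Binary.Core using (Rel)
open import Relation.Binary.Definitions using (tri<; tri≈; tri>)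
open import Relation.Binary.Morphism.Structures using (IsOrderIsomorphism)
open import Relation.Binary.PropositionalEquality.Properties using () renaming (setoid to ≡-setoid)
open import Relation.Binary.Structures using (IsStrictTotalOrder)
import Relation.Binary.Construct.On as On
import Relation.Binary.Reasoning.Setoid as SetoidReasoning
open import Relation.Nullary.Decidable.Core using (Dec; yes; no)
open import Relation.Nullary.Negation.Core using (¬_)
open import Relation.Unary using (Pred)

record OrderedAbelianGroup (u : Level) : Set (lsuc u) where
  infix  4 _≈_ _≺_ _≼_
  infixl 7 _∙_
  field
    Carrier            : Set u
    _≈_ _≺_            : Rel Carrier u
    _∙_                : Op₂ Carrier
    ε                  : Carrier
    _⁻¹                : Op₁ Carrier
    isAbelianGroup     : IsAbelianGroup _≈_ _∙_ ε _⁻¹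
    isStrictTotalOrder : IsStrictTotalOrder _≈_ _≺_
    ∙-monoʳ-≺          : ∀ c {a b} → a ≺ b → c ∙ a ≺ c ∙ b

  _≼_ : Rel Carrier u
  a ≼ b = ¬ b ≺ a

  abelianGroup : AbelianGroup u u
  abelianGroup = record { isAbelianGroup = isAbelianGroup }

  open AbelianGroup abelianGroup public
    using (setoid; refl; sym; trans; ∙-cong; assoc; comm; identityˡ; identityʳ; inverseʳ; inverseˡ; ⁻¹-cong)
  open IsStrictTotalOrder isStrictTotalOrder public
    using (compare; _≟_; irrefl; asym; <-resp-≈; <-respʳ-≈; <-respˡ-≈)
    renaming (trans to ≺-trans)

record OrderedField (u : Level) : Set (lsuc u) where
  infix  4 _≈_ _<_
  infixl 7 _*_
  infixl 6 _+_
  infix  8 -_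
  field
    Carrier            : Set u
    _≈_ _<_            : Rel Carrier u
    _+_ _*_            : Op₂ Carrier
    -_                 : Op₁ Carrier
    0# 1#              : Carrier
    isCommutativeRing  : IsCommutativeRing _≈_ _+_ _*_ -_ 0# 1#
    inverse            : ∀ a → ¬ a ≈ 0# → ∃ λ b → a * b ≈ 1#
    isStrictTotalOrder : IsStrictTotalOrder _≈_ _<_
    0<1                : 0# < 1#
    +-monoʳ-<          : ∀ c {a b} → a < b → c + a < c + b
    *-pos              : ∀ {a b} → 0# < a → 0# < b → 0# < a * b

  commutativeRing : CommutativeRing u u
  commutativeRing = record { isCommutativeRing = isCommutativeRing }

  open CommutativeRing commutativeRing public
    using ( setoid; refl; sym; trans; ring; +-cong; +-congˡ; +-congʳ; +-assoc; +-comm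
          ; +-identityˡ; +-identityʳ; -‿cong; -‿inverseʳ; -‿inverseˡ
          ; *-cong; *-congˡ; *-congʳ; zeroˡ; zeroʳ; +-group)
  open IsStrictTotalOrder isStrictTotalOrder public
    using (compare; _≟_; irrefl; asym; <-resp-≈; <-respʳ-≈; <-respˡ-≈)
    renaming (trans to <-trans)

  -0≈0 : - 0# ≈ 0#
  -0≈0 = RingProperties.-0#≈0# ring

  fromℕ⁺ : ℕ → Carrier
  fromℕ⁺ zero    = 1#
  fromℕ⁺ (suc k) = 1# + fromℕ⁺ k

  fromℕ⁺-pos : ∀ k → 0# < fromℕ⁺ k
  fromℕ⁺-pos zero    = 0<1
  fromℕ⁺-pos (suc k) =
    <-trans 0<1 (<-respˡ-≈ (+-identityʳ 1#) (+-monoʳ-< 1# (fromℕ⁺-pos k)))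

  -- recip k is 1/(k+1), fromℕ⁺ k being k+1.
  recip : ℕ → Carrier
  recip k = proj₁ (inverse (fromℕ⁺ k) λ e → irrefl (sym e) (fromℕ⁺-pos k))

  recip! : ℕ → Carrier
  recip! zero    = 1#
  recip! (suc k) = recip! k * recip k

  sign : ℕ → Carrier
  sign zero    = 1#
  sign (suc k) = - sign k

-- Between groups, preserving the operation entails preserving unit and inverses.
record IsOrderedMagmaIsomorphism
  {a b ℓ₁ ℓ₂ ℓ₃ ℓ₄ : Level}
  (M₁ : RawMagma a ℓ₁) (_<₁_ : Rel (RawMagma.Carrier M₁) ℓ₃)
  (M₂ : RawMagma b ℓ₂) (_<₂_ : Rel (RawMagma.Carrier M₂) ℓ₄)
  (⟦_⟧ : RawMagma.Carrier M₁ → RawMagma.Carrier M₂)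
  : Set (a ⊔ b ⊔ ℓ₁ ⊔ ℓ₂ ⊔ ℓ₃ ⊔ ℓ₄) where
  field
    isMagmaIsomorphism : MagmaMorphisms.IsMagmaIsomorphism M₁ M₂ ⟦_⟧
    isOrderIsomorphism : IsOrderIsomorphism (RawMagma._≈_ M₁) (RawMagma._≈_ M₂) _<₁_ _<₂_ ⟦_⟧

record IsOrderedGroupIsomorphism
  {a b ℓ₁ ℓ₂ ℓ₃ ℓ₄ : Level}
  (G₁ : RawGroup a ℓ₁) (_<₁_ : Rel (RawGroup.Carrier G₁) ℓ₃)
  (G₂ : RawGroup b ℓ₂) (_<₂_ : Rel (RawGroup.Carrier G₂) ℓ₄)
  (⟦_⟧ : RawGroup.Carrier G₁ → RawGroup.Carrier G₂)
  : Set (a ⊔ b ⊔ ℓ₁ ⊔ ℓ₂ ⊔ ℓ₃ ⊔ ℓ₄) where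
  field
    isGroupIsomorphism : GroupMorphisms.IsGroupIsomorphism G₁ G₂ ⟦_⟧
    isOrderIsomorphism : IsOrderIsomorphism (RawGroup._≈_ G₁) (RawGroup._≈_ G₂) _<₁_ _<₂_ ⟦_⟧

module _ {a ℓ : Level} (G : Group a ℓ) where
  open Group G
  open SetoidReasoning setoid

  Conjugate : Carrier → Carrier → Set (a ⊔ ℓ)
  Conjugate f g = ∃ λ h → h ∙ f ≈ g ∙ h

  Centralizer : Carrier → Group (a ⊔ ℓ) ℓ
  Centralizer f = record
    { Carrier = ∃ λ h → h ∙ f ≈ f ∙ h
    ; _≈_     = _≈_ on proj₁
    ; _∙_     = λ (h , p) (k , q) → h ∙ k , (begin
        (h ∙ k) ∙ f  ≈⟨ assoc h k f ⟩
        h ∙ (k ∙ f)  ≈⟨ ∙-congˡ q ⟩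
        h ∙ (f ∙ k)  ≈⟨ assoc h f k ⟨
        (h ∙ f) ∙ k  ≈⟨ ∙-congʳ p ⟩
        (f ∙ h) ∙ k  ≈⟨ assoc f h k ⟩
        f ∙ (h ∙ k)  ∎)
    ; ε       = ε , trans (identityˡ f) (sym (identityʳ f))
    ; _⁻¹     = λ (h , p) → h ⁻¹ , (begin
        h ⁻¹ ∙ f                  ≈⟨ identityʳ _ ⟨
        h ⁻¹ ∙ f ∙ ε              ≈⟨ ∙-congˡ (inverseʳ h) ⟨
        h ⁻¹ ∙ f ∙ (h ∙ h ⁻¹)     ≈⟨ assoc _ h (h ⁻¹) ⟨
        h ⁻¹ ∙ f ∙ h ∙ h ⁻¹       ≈⟨ ∙-congʳ (assoc (h ⁻¹) f h) ⟩
        h ⁻¹ ∙ (f ∙ h) ∙ h ⁻¹     ≈⟨ ∙-congʳ (∙-congˡ p) ⟨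
        h ⁻¹ ∙ (h ∙ f) ∙ h ⁻¹     ≈⟨ ∙-congʳ (assoc (h ⁻¹) h f) ⟨
        h ⁻¹ ∙ h ∙ f ∙ h ⁻¹       ≈⟨ ∙-congʳ (∙-congʳ (inverseˡ h)) ⟩
        ε ∙ f ∙ h ⁻¹              ≈⟨ ∙-congʳ (identityˡ f) ⟩
        f ∙ h ⁻¹                  ∎)
    ; isGroup = record
      { isMonoid = record
        { isSemigroup = record
          { isMagma = record
            { isEquivalence = record { refl = refl ; sym = sym ; trans = trans }
            ; ∙-cong        = ∙-cong
            }
          ; assoc = λ (h , _) (k , _) (l , _) → assoc h k l
          }
        ; identity = (λ (h , _) → identityˡ h) , (λ (h , _) → identityʳ h)
        }
      ; inverse = (λ (h , _) → inverseˡ h) , (λ (h , _) → inverseʳ h)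
      ; ⁻¹-cong = ⁻¹-cong
      }
    }

-- Types in Set u play the role of classes and types in Set ℓ that of sets, so
-- that 𝐑 and 𝔑 may be proper classes. The ambient logic is classical: excluded
-- middle is what makes products and absolute values of series total operations.

module WellBased {u : Level} (ℓ : Level) (em : ExcludedMiddle u)
                 (𝐑 : OrderedField u) (𝔑 : OrderedAbelianGroup u) where

  module R = OrderedField 𝐑
  module N = OrderedAbelianGroup 𝔑
  open R using (0#; 1#)
  open N using (_≺_; _≼_; _∙_; ε; _⁻¹)

  Small : ∀ {p} → Pred N.Carrier p → Set (u ⊔ p ⊔ lsuc ℓ)
  Small P = ∃ λ (I : Set ℓ) → Σ (I → N.Carrier) λ e → ∀ m → P m → ∃ λ i → e i N.≈ m

  -- As ≻ is a strict total order, P is well ordered by ≻ when ≻ is well founded on it.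
  WellOrdered : ∀ {p} → Pred N.Carrier p → Set (u ⊔ p)
  WellOrdered P = WellFounded {A = ∃ P} λ (m , _) (n , _) → n ≺ m

  IsMax : Pred N.Carrier u → Pred N.Carrier u
  IsMax P m = P m × ∀ n → P n → n ≼ m

  module _ {i j} (I : Setoid i j) where
    open Setoid I using () renaming (Carrier to |I|)
    open Membership I using (_∈_)

    Enumeration : ∀ {p} → Pred |I| p → Set (i ⊔ j ⊔ p)
    Enumeration P = ∃ λ (L : List |I|) → Unique.Unique I L × ∀ i → P i → i ∈ L

  sumOver : ∀ {i} {I : Set i} → List I → (I → R.Carrier) → R.Carrier
  sumOver L f = foldr (λ i r → f i R.+ r) 0# L

  HasMaxima : Pred N.Carrier u → Set (lsuc u)
  HasMaxima P = ∀ (Q : Pred N.Carrier u) → (∀ m → Q m → P m) → ∃ Q → ∃ (IsMax Q)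

  wellOrdered⇒maxima : ∀ {P} → WellOrdered P → HasMaxima P
  wellOrdered⇒maxima {P} wo Q Q⊆P (m , q) = go (m , Q⊆P m q) (wo _) q
    where
    go : ∀ mp → Acc (λ (m , _) (n , _) → n ≺ m) mp → Q (proj₁ mp) → ∃ (IsMax Q)
    go (m , p) (acc rs) q with em {∃ λ n → Q n × m ≺ n}
    ... | yes (n , q′ , m≺n) = go (n , Q⊆P n q′) (rs m≺n) q′
    ... | no ¬∃ = m , q , λ n q′ m≺n → ¬∃ (n , q′ , m≺n)

  maxima⇒wellOrdered : ∀ {P} → HasMaxima P → WellOrdered P
  maxima⇒wellOrdered {P} maxima mp@(m , p) with em {Acc (λ (m , _) (n , _) → n ≺ m) mp}
  ... | yes a = a
  ... | no ¬a with maxima (λ n → Σ (P n) λ q → ¬ Acc (λ (m , _) (n , _) → n ≺ m) (n , q))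
                          (λ _ → proj₁) (m , p , ¬a)
  ...   | n , (q , ¬b) , max = ⊥-elim (¬b (acc bigger))
    where
    bigger : ∀ {kp : ∃ P} → n ≺ proj₁ kp → Acc (λ (m , _) (n , _) → n ≺ m) kp
    bigger {k , p′} n≺k with em {Acc (λ (m , _) (n , _) → n ≺ m) (k , p′)}
    ... | yes b = b
    ... | no ¬c = ⊥-elim (max k (p′ , ¬c) n≺k)

  wellOrdered-⊆ : ∀ {p q} {P : Pred N.Carrier p} {Q : Pred N.Carrier q} →
                  (∀ m → P m → Q m) → WellOrdered Q → WellOrdered P
  wellOrdered-⊆ P⊆Q wo = On.wellFounded (λ (m , p) → m , P⊆Q m p) wo

  small-⊆ : ∀ {p q} {P : Pred N.Carrier p} {Q : Pred N.Carrier q} →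
            (∀ m → P m → Q m) → Small Q → Small P
  small-⊆ P⊆Q (I , e , c) = I , e , λ m p → c m (P⊆Q m p)

  wellOrdered-∪ : ∀ {P P′ : Pred N.Carrier u} → WellOrdered P → WellOrdered P′ →
                  WellOrdered (λ m → P m ⊎ P′ m)
  wellOrdered-∪ {P} {P′} wo wo′ = maxima⇒wellOrdered maxima
    where
    maxima : HasMaxima (λ m → P m ⊎ P′ m)
    maxima Q Q⊆ (m₀ , q₀) with em {∃ λ m → Q m × P m} | em {∃ λ m → Q m × P′ m}
    ... | no ¬∃ | no ¬∃′ with Q⊆ m₀ q₀
    ...   | inj₁ p = ⊥-elim (¬∃ (m₀ , q₀ , p))
    ...   | inj₂ p = ⊥-elim (¬∃′ (m₀ , q₀ , p))
    maxima Q Q⊆ (m₀ , q₀) | yes e | no ¬∃′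
      with wellOrdered⇒maxima wo (λ m → Q m × P m) (λ _ → proj₂) e
    ... | m , (q , _) , max = m , q , λ n q′ → case n q′ (Q⊆ n q′)
      where
      case : ∀ n → Q n → P n ⊎ P′ n → n ≼ m
      case n q (inj₁ p) = max n (q , p)
      case n q (inj₂ p) = ⊥-elim (¬∃′ (n , q , p))
    maxima Q Q⊆ (m₀ , q₀) | no ¬∃ | yes e
      with wellOrdered⇒maxima wo′ (λ m → Q m × P′ m) (λ _ → proj₂) e
    ... | m , (q , _) , max = m , q , λ n q′ → case n q′ (Q⊆ n q′)
      where
      case : ∀ n → Q n → P n ⊎ P′ n → n ≼ m
      case n q (inj₁ p) = ⊥-elim (¬∃ (n , q , p))
      case n q (inj₂ p) = max n (q , p)
    maxima Q Q⊆ (m₀ , q₀) | yes e | yes e′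
      with wellOrdered⇒maxima wo (λ m → Q m × P m) (λ _ → proj₂) e
         | wellOrdered⇒maxima wo′ (λ m → Q m × P′ m) (λ _ → proj₂) e′
    ... | m , (q , _) , max | m′ , (q′ , _) , max′ with N.compare m m′
    ...   | tri< m≺m′ _ _ = m′ , q′ , λ n r → case n r (Q⊆ n r)
      where
      case : ∀ n → Q n → P n ⊎ P′ n → n ≼ m′
      case n r (inj₁ p) m′≺n = max n (r , p) (N.≺-trans m≺m′ m′≺n)
      case n r (inj₂ p) = max′ n (r , p)
    ...   | tri≈ _ m≈m′ _ = m , q , λ n r → case n r (Q⊆ n r)
      where
      case : ∀ n → Q n → P n ⊎ P′ n → n ≼ m
      case n r (inj₁ p) = max n (r , p)
      case n r (inj₂ p) m≺n = max′ n (r , p) (N.<-respˡ-≈ m≈m′ m≺n)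
    ...   | tri> _ _ m′≺m = m , q , λ n r → case n r (Q⊆ n r)
      where
      case : ∀ n → Q n → P n ⊎ P′ n → n ≼ m
      case n r (inj₁ p) = max n (r , p)
      case n r (inj₂ p) m≺n = max′ n (r , p) (N.≺-trans m′≺m m≺n)

  ∙-monoˡ-≺ : ∀ c {a b} → a ≺ b → a ∙ c ≺ b ∙ c
  ∙-monoˡ-≺ c {a} {b} a≺b =
    N.<-respˡ-≈ (N.comm c a) (N.<-respʳ-≈ (N.comm c b) (N.∙-monoʳ-≺ c a≺b))

  ∙-mono-≼ : ∀ {a a′ b b′} → a ≼ a′ → b ≼ b′ → a ∙ b ≼ a′ ∙ b′
  ∙-mono-≼ {a} {a′} {b} {b′} a≼ b≼ lt with N.compare a a′ | N.compare b b′
  ... | tri> _ _ gt  | _ = a≼ gt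
  ... | tri< _ _ _   | tri> _ _ gt = b≼ gt
  ... | tri≈ _ _ _   | tri> _ _ gt = b≼ gt
  ... | tri< a≺ _ _  | tri< b≺ _ _ =
    N.asym lt (N.≺-trans (∙-monoˡ-≺ b a≺) (N.∙-monoʳ-≺ a′ b≺))
  ... | tri< a≺ _ _  | tri≈ _ b≈ _ =
    N.asym lt (N.<-respʳ-≈ (N.∙-cong N.refl b≈) (∙-monoˡ-≺ b a≺))
  ... | tri≈ _ a≈ _  | tri< b≺ _ _ =
    N.asym lt (N.<-respˡ-≈ (N.∙-cong (N.sym a≈) N.refl) (N.∙-monoʳ-≺ a′ b≺))
  ... | tri≈ _ a≈ _  | tri≈ _ b≈ _ = N.irrefl (N.sym (N.∙-cong a≈ b≈)) lt

  small-∪ : ∀ {P P′ : Pred N.Carrier u} → Small P → Small P′ → Small (λ m → P m ⊎ P′ m)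
  small-∪ (I , e , c) (I′ , e′ , c′) = (I ⊎ I′) , Sum.[ e , e′ ] , λ where
    m (inj₁ p) → let i , q = c m p  in inj₁ i , q
    m (inj₂ p) → let i , q = c′ m p in inj₂ i , q

  small-∙ : ∀ {P P′ : Pred N.Carrier u} → Small P → Small P′ →
            Small (λ m → ∃ λ a → ∃ λ b → P a × P′ b × m N.≈ a ∙ b)
  small-∙ (I , e , c) (I′ , e′ , c′) = (I × I′) , (λ (i , j) → e i ∙ e′ j) , λ where
    m (a , b , p , p′ , m≈) →
      let i , q = c a p ; j , q′ = c′ b p′
      in (i , j) , N.trans (N.∙-cong q q′) (N.sym m≈)

  -- Consider the a ∙ b in Q such that a′ ≼ a for all larger a′ ∙ b′ in Q. They
  -- are cofinal in Q, and the one with b maximal is the maximum of Q.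
  wellOrdered-∙ : ∀ {P P′ : Pred N.Carrier u} → WellOrdered P → WellOrdered P′ →
                  WellOrdered (λ m → ∃ λ a → ∃ λ b → P a × P′ b × m N.≈ a ∙ b)
  wellOrdered-∙ {P} {P′} wo wo′ = maxima⇒wellOrdered maxima
    where
    maxima : HasMaxima (λ m → ∃ λ a → ∃ λ b → P a × P′ b × m N.≈ a ∙ b)
    maxima Q Q⊆ (m₀ , q₀) = m , q , λ n r → greatest n r
      where
      Rep : N.Carrier → N.Carrier → N.Carrier → Set u
      Rep m a b = Q m × P a × P′ b × m N.≈ a ∙ b

      Good : N.Carrier → N.Carrier → N.Carrier → Set u
      Good m a b = Rep m a b × ∀ m′ a′ b′ → Rep m′ a′ b′ → m ≺ m′ → a′ ≼ a

      good : ∀ n → Q n → ∃ λ m → ∃ λ a → ∃ λ b → Good m a b × n ≼ m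
      good n r
        with wellOrdered⇒maxima wo (λ a → ∃ λ b → ∃ λ m → Rep m a b × n ≼ m)
               (λ { _ (_ , _ , (_ , p , _) , _) → p })
               (let a , b , p , p′ , e = Q⊆ n r
                in a , b , n , (r , p , p′ , e) , N.irrefl N.refl)
      ... | a , (b , m , rep , n≼m) , max =
        m , a , b , (rep , λ m′ a′ b′ rep′ m≺m′ → max a′ (b′ , m′ , rep′ , above m≺m′)) , n≼m
        where
        above : ∀ {m′} → m ≺ m′ → n ≼ m′
        above m≺m′ m′≺n = n≼m (N.≺-trans m≺m′ m′≺n)

      best : ∃ (IsMax (λ b → ∃ λ m → ∃ λ a → Good m a b))
      best = wellOrdered⇒maxima wo′ _ (λ { _ (_ , _ , (_ , _ , p , _) , _) → p })
               (let m , a , b , g , _ = good m₀ q₀ in b , m , a , g)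

      b = proj₁ best
      m = proj₁ (proj₁ (proj₂ best))
      a = proj₁ (proj₂ (proj₁ (proj₂ best)))

      g : Good m a b
      g = proj₂ (proj₂ (proj₁ (proj₂ best)))

      q : Q m
      q = proj₁ (proj₁ g)

      greatest : ∀ n → Q n → n ≼ m
      greatest n r m≺n with good n r
      ... | m₂ , a₂ , b₂ , g₂@((q₂ , p₂ , p₂′ , e₂) , _) , n≼m₂ =
        ∙-mono-≼ (proj₂ g m₂ a₂ b₂ (proj₁ g₂) m≺m₂) (proj₂ (proj₂ best) b₂ (m₂ , a₂ , g₂))
          (N.<-respˡ-≈ (proj₂ (proj₂ (proj₂ (proj₁ g)))) (N.<-respʳ-≈ e₂ m≺m₂))
        where
        m≺m₂ : m ≺ m₂
        m≺m₂ with N.compare n m₂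
        ... | tri< n≺ _ _ = N.≺-trans m≺n n≺
        ... | tri≈ _ n≈ _ = N.<-respʳ-≈ n≈ m≺n
        ... | tri> _ _ gt = ⊥-elim (n≼m₂ gt)

  -- A class all of whose nonempty subclasses have a greatest and a least
  -- element is finite.
  enumerate : ∀ {P : Pred N.Carrier u} → WellOrdered P →
              (∀ (Q : Pred N.Carrier u) → (∀ m → Q m → P m) → ∃ Q →
               ∃ λ m → Q m × ∀ n → Q n → m ≼ n) →
              Enumeration N.setoid P
  enumerate {P} wo minima with em {∃ P}
  ... | no ¬∃ = [] , [] , λ m p → ⊥-elim (¬∃ (m , p))
  ... | yes e with minima P (λ _ p → p) e
  ...   | m₀ , p₀ , min₀ = let L , uniq , _ , complete = from (m₀ , p₀) (wo _)
                           in L , uniq , λ n p → complete n p (min₀ n p)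
    where
    open Membership N.setoid using (_∈_)

    from : ∀ mp → Acc (λ (m , _) (n , _) → n ≺ m) mp → let m = proj₁ mp in
           ∃ λ L → Unique.Unique N.setoid L × All (m ≼_) L × (∀ n → P n → m ≼ n → n ∈ L)
    from (m , p) (acc rs) with em {∃ λ n → P n × m ≺ n}
    ... | no ¬∃ = m ∷ [] , [] ∷ [] , N.irrefl N.refl ∷ [] , λ n p′ m≼n → here (only n p′ m≼n)
      where
      only : ∀ n → P n → m ≼ n → n N.≈ m
      only n p′ m≼n with N.compare n m
      ... | tri< n≺m _ _ = ⊥-elim (m≼n n≺m)
      ... | tri≈ _ n≈m _ = n≈m
      ... | tri> _ _ m≺n = ⊥-elim (¬∃ (n , p′ , m≺n))
    ... | yes e′ with minima (λ n → P n × m ≺ n) (λ _ → proj₁) e′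
    ...   | k , (pk , m≺k) , min with from (k , pk) (rs m≺k)
    ...     | L , uniq , k≼L , complete =
      m ∷ L , All.map (λ k≼n m≈n → k≼n (N.<-respˡ-≈ m≈n m≺k)) k≼L ∷ uniq ,
      N.irrefl N.refl ∷ All.map (λ k≼n n≺m → k≼n (N.≺-trans n≺m m≺k)) k≼L ,
      λ n p′ m≼n → member n p′ m≼n
      where
      member : ∀ n → P n → m ≼ n → n ∈ m ∷ L
      member n p′ m≼n with N.compare n m
      ... | tri< n≺m _ _ = ⊥-elim (m≼n n≺m)
      ... | tri≈ _ n≈m _ = here n≈m
      ... | tri> _ _ m≺n = there (complete n p′ (min n (p′ , m≺n)))

  module _ {i j} (I : Setoid i j) where
    open Setoid I using () renaming (Carrier to |I|; _≈_ to _≈ᵢ_)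
    open Membership I using (_∈_)
    open Unique I using (Unique)
    open SetoidReasoning R.setoid
    private module I = Setoid I

    sumOver-zero : ∀ L (f : |I| → R.Carrier) → (∀ {i} → i ∈ L → f i R.≈ 0#) → sumOver L f R.≈ 0#
    sumOver-zero []      f z = R.refl
    sumOver-zero (i ∷ L) f z = R.trans
      (R.+-cong (z (here I.refl)) (sumOver-zero L f λ e → z (there e)))
      (R.+-identityˡ 0#)

    sumOver-nonzero : ∀ L (f : |I| → R.Carrier) → ¬ sumOver L f R.≈ 0# → ∃ λ i → ¬ f i R.≈ 0#
    sumOver-nonzero []      f nz = ⊥-elim (nz R.refl)
    sumOver-nonzero (i ∷ L) f nz with f i R.≟ 0#
    ... | no fi≉0  = i , fi≉0
    ... | yes fi≈0 = sumOver-nonzero L f λ z →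
      nz (R.trans (R.+-cong fi≈0 z) (R.+-identityˡ 0#))

    sumOver-cong : ∀ L {f g : |I| → R.Carrier} → (∀ i → f i R.≈ g i) → sumOver L f R.≈ sumOver L g
    sumOver-cong []      e = R.refl
    sumOver-cong (i ∷ L) e = R.+-cong (e i) (sumOver-cong L e)

    ∈-─⁺ : ∀ {x i L} (p : x ∈ L) → i ∈ L → ¬ i ≈ᵢ x → i ∈ (L ─ p)
    ∈-─⁺ (here x≈y) (here i≈y) i≉x = ⊥-elim (i≉x (I.trans i≈y (I.sym x≈y)))
    ∈-─⁺ (here _)   (there q)  i≉x = q
    ∈-─⁺ (there p)  (here i≈y) i≉x = here i≈y
    ∈-─⁺ (there p)  (there q)  i≉x = there (∈-─⁺ p q i≉x)

    ∈-─⁻ : ∀ {x i L} (p : x ∈ L) → i ∈ (L ─ p) → i ∈ L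
    ∈-─⁻ (here _)  q          = there q
    ∈-─⁻ (there p) (here i≈y) = here i≈y
    ∈-─⁻ (there p) (there q)  = there (∈-─⁻ p q)

    ∉-head : ∀ {x L} → Unique (x ∷ L) → ¬ x ∈ L
    ∉-head (x≉ ∷ _) = All¬⇒¬Any x≉

    ∉-─ : ∀ {x i L} → Unique L → (p : x ∈ L) → i ∈ (L ─ p) → ¬ i ≈ᵢ x
    ∉-─ (y≉ ∷ _)    (here x≈y) q          i≈x =
      All¬⇒¬Any y≉ (∈-resp-≈ I (I.trans i≈x x≈y) q)
    ∉-─ (y≉ ∷ _)    (there p)  (here i≈y) i≈x =
      All¬⇒¬Any y≉ (∈-resp-≈ I (I.trans (I.sym i≈x) i≈y) p)
    ∉-─ (_ ∷ uniq)  (there p)  (there q)  i≈x = ∉-─ uniq p q i≈x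

    unique-─ : ∀ {x L} → Unique L → (p : x ∈ L) → Unique (L ─ p)
    unique-─ (_ ∷ uniq)  (here _)  = uniq
    unique-─ (y≉ ∷ uniq) (there p) =
      ¬Any⇒All¬ _ (λ q → All¬⇒¬Any y≉ (∈-─⁻ p q)) ∷ unique-─ uniq p

    module _ {f : |I| → R.Carrier} (f-cong : ∀ {i j} → i ≈ᵢ j → f i R.≈ f j) where

      sumOver-─ : ∀ {x L} (p : x ∈ L) → sumOver L f R.≈ f x R.+ sumOver (L ─ p) f
      sumOver-─ (here x≈y) = R.+-congʳ (f-cong (I.sym x≈y))
      sumOver-─ {x} {y ∷ L} (there p) = begin
        f y R.+ sumOver L f                       ≈⟨ R.+-congˡ (sumOver-─ p) ⟩
        f y R.+ (f x R.+ sumOver (L ─ p) f)       ≈⟨ R.+-assoc _ _ _ ⟨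
        (f y R.+ f x) R.+ sumOver (L ─ p) f       ≈⟨ R.+-congʳ (R.+-comm _ _) ⟩
        (f x R.+ f y) R.+ sumOver (L ─ p) f       ≈⟨ R.+-assoc _ _ _ ⟩
        f x R.+ (f y R.+ sumOver (L ─ p) f)       ∎

      sumOver-unique : ∀ L L′ → Unique L → Unique L′ →
                       (∀ i → ¬ f i R.≈ 0# → i ∈ L → i ∈ L′) →
                       (∀ i → ¬ f i R.≈ 0# → i ∈ L′ → i ∈ L) →
                       sumOver L f R.≈ sumOver L′ f
      sumOver-unique [] L′ u u′ to from = R.sym (sumOver-zero L′ f zeros)
        where
        zeros : ∀ {i} → i ∈ L′ → f i R.≈ 0#
        zeros {i} q with f i R.≟ 0#
        ... | yes z = z
        ... | no nz with from i nz q
        ...   | ()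
      sumOver-unique (x ∷ L) L′ u@(_ ∷ uniq) u′ to from with f x R.≟ 0#
      ... | yes z = R.trans (R.+-congʳ z) (R.trans (R.+-identityˡ _)
                      (sumOver-unique L L′ uniq u′ (λ i nz q → to i nz (there q)) from′))
        where
        from′ : ∀ i → ¬ f i R.≈ 0# → i ∈ L′ → i ∈ L
        from′ i nz q with from i nz q
        ... | here i≈x = ⊥-elim (nz (R.trans (f-cong i≈x) z))
        ... | there q′ = q′
      ... | no nz₀ = R.trans (R.+-congˡ (sumOver-unique L (L′ ─ p) uniq (unique-─ u′ p) to′ from′))
                             (R.sym (sumOver-─ p))
        where
        p : x ∈ L′
        p = to x nz₀ (here I.refl)

        to′ : ∀ i → ¬ f i R.≈ 0# → i ∈ L → i ∈ (L′ ─ p)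
        to′ i nz q = ∈-─⁺ p (to i nz (there q)) λ i≈x → ∉-head u (∈-resp-≈ I i≈x q)

        from′ : ∀ i → ¬ f i R.≈ 0# → i ∈ (L′ ─ p) → i ∈ L
        from′ i nz q with from i nz (∈-─⁻ p q)
        ... | here i≈x = ⊥-elim (∉-─ u′ p q i≈x)
        ... | there q′ = q′

  -- The sum of f over an enumeration of its nonzero terms does not depend on
  -- the enumeration.
  module _ {i j} (I : Setoid i j) where
    private module I = Setoid I

    sumOver-enumeration :
      ∀ {f g : I.Carrier → R.Carrier} → (∀ {i j} → i I.≈ j → f i R.≈ f j) →
      (∀ i → f i R.≈ g i) →
      (E : Enumeration I (λ i → ¬ f i R.≈ 0#)) (E′ : Enumeration I (λ i → ¬ g i R.≈ 0#)) →
      sumOver (proj₁ E) f R.≈ sumOver (proj₁ E′) g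
    sumOver-enumeration {f} {g} f-cong f≈g (L , u , c) (L′ , u′ , c′) = R.trans
      (sumOver-unique I f-cong L L′ u u′
        (λ i nz _ → c′ i λ z → nz (R.trans (f≈g i) z)) (λ i nz _ → c i nz))
      (sumOver-cong I L′ f≈g)

  record Series : Set (u ⊔ lsuc ℓ) where
    field
      coeff      : N.Carrier → R.Carrier
      coeff-cong : ∀ {m n} → m N.≈ n → coeff m R.≈ coeff n

    supp : Pred N.Carrier u
    supp m = ¬ coeff m R.≈ 0#

    field
      small       : Small supp
      wellOrdered : WellOrdered supp

  open Series

  infix  4 _≈_
  infixl 6 _+_ _-_
  infixl 7 _·_
  infix  8 -_
  infixr 9 _^_

  _≈_ : Rel Series u
  s ≈ t = ∀ m → coeff s m R.≈ coeff t m

  supp-cong : ∀ s {m n} → m N.≈ n → supp s m → supp s n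
  supp-cong s m≈n nz z = nz (R.trans (coeff-cong s m≈n) z)

  0ₛ : Series
  0ₛ = record
    { coeff       = λ _ → 0#
    ; coeff-cong  = λ _ → R.refl
    ; small       = Lift ℓ ⊥ , (λ ()) , λ m nz → ⊥-elim (nz R.refl)
    ; wellOrdered = λ (m , nz) → ⊥-elim (nz R.refl)
    }

  _+_ : Series → Series → Series
  s + t = record
    { coeff       = λ m → coeff s m R.+ coeff t m
    ; coeff-cong  = λ e → R.+-cong (coeff-cong s e) (coeff-cong t e)
    ; small       = small-⊆ split (small-∪ (small s) (small t))
    ; wellOrdered = wellOrdered-⊆ split (wellOrdered-∪ (wellOrdered s) (wellOrdered t))
    }
    where
    split : ∀ m → ¬ coeff s m R.+ coeff t m R.≈ 0# → supp s m ⊎ supp t m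
    split m nz with coeff s m R.≟ 0#
    ... | no nz′ = inj₁ nz′
    ... | yes z  = inj₂ λ z′ → nz (R.trans (R.+-cong z z′) (R.+-identityˡ 0#))

  -_ : Series → Series
  - s = record
    { coeff       = λ m → R.- coeff s m
    ; coeff-cong  = λ e → R.-‿cong (coeff-cong s e)
    ; small       = small-⊆ nonzero (small s)
    ; wellOrdered = wellOrdered-⊆ nonzero (wellOrdered s)
    }
    where
    nonzero : ∀ m → ¬ R.- coeff s m R.≈ 0# → supp s m
    nonzero m nz z = nz (R.trans (R.-‿cong z) R.-0≈0)

  _-_ : Series → Series → Series
  s - t = s + (- t)

  _·_ : R.Carrier → Series → Series
  r · s = record
    { coeff       = λ m → r R.* coeff s m
    ; coeff-cong  = λ e → R.*-congˡ (coeff-cong s e)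
    ; small       = small-⊆ nonzero (small s)
    ; wellOrdered = wellOrdered-⊆ nonzero (wellOrdered s)
    }
    where
    nonzero : ∀ m → ¬ r R.* coeff s m R.≈ 0# → supp s m
    nonzero m nz z = nz (R.trans (R.*-congˡ z) (R.zeroʳ r))

  monomial : N.Carrier → Series
  monomial n = record
    { coeff       = λ m → δ (m N.≟ n)
    ; coeff-cong  = λ {m} {m′} e → δ-cong e (m N.≟ n) (m′ N.≟ n)
    ; small       = Lift ℓ ⊤ , (λ _ → n) , λ m nz → _ , N.sym (only m nz)
    ; wellOrdered = λ (m , nz) → acc λ { {m′ , nz′} m≺m′ →
        ⊥-elim (N.irrefl (N.trans (only m nz) (N.sym (only m′ nz′))) m≺m′) }
    }
    where
    δ : ∀ {m} → Dec (m N.≈ n) → R.Carrier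
    δ (yes _) = 1#
    δ (no _)  = 0#

    δ-cong : ∀ {m m′} → m N.≈ m′ → (d : Dec (m N.≈ n)) (d′ : Dec (m′ N.≈ n)) → δ d R.≈ δ d′
    δ-cong e (yes _)  (yes _)   = R.refl
    δ-cong e (yes p)  (no ¬p)   = ⊥-elim (¬p (N.trans (N.sym e) p))
    δ-cong e (no ¬p)  (yes p)   = ⊥-elim (¬p (N.trans e p))
    δ-cong e (no _)   (no _)    = R.refl

    only : ∀ m → ¬ δ (m N.≟ n) R.≈ 0# → m N.≈ n
    only m nz with m N.≟ n
    ... | yes p = p
    ... | no _  = ⊥-elim (nz R.refl)

  const : R.Carrier → Series
  const r = r · monomial ε

  1ₛ : Series
  1ₛ = monomial ε

  module _ (s t : Series) where

    convolution : N.Carrier → N.Carrier → R.Carrier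
    convolution m a = coeff s a R.* coeff t (a ⁻¹ ∙ m)

    convolution-supp : ∀ m a → ¬ convolution m a R.≈ 0# → supp s a × supp t (a ⁻¹ ∙ m)
    convolution-supp m a nz =
      (λ z → nz (R.trans (R.*-congʳ z) (R.zeroˡ _))) ,
      (λ z → nz (R.trans (R.*-congˡ z) (R.zeroʳ _)))

    convolution-cong : ∀ {m m′ a a′} → m N.≈ m′ → a N.≈ a′ →
                       convolution m a R.≈ convolution m′ a′
    convolution-cong m≈ a≈ = R.*-cong (coeff-cong s a≈) (coeff-cong t (N.∙-cong (N.⁻¹-cong a≈) m≈))

    -- For fixed m, the map a ↦ a ⁻¹ ∙ m reverses the order.
    enumerateFactors : ∀ m → Enumeration N.setoid (λ a → ¬ convolution m a R.≈ 0#)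
    enumerateFactors m = enumerate
      (wellOrdered-⊆ (λ a nz → proj₁ (convolution-supp m a nz)) (wellOrdered s)) minima
      where
      minima : ∀ (Q : Pred N.Carrier u) → (∀ a → Q a → ¬ convolution m a R.≈ 0#) → ∃ Q →
               ∃ λ a → Q a × ∀ b → Q b → a ≼ b
      minima Q Q⊆ (a₀ , q₀)
        with wellOrdered⇒maxima (wellOrdered t) (λ v → ∃ λ a → Q a × v N.≈ a ⁻¹ ∙ m)
               (λ { v (a , q , e) → supp-cong t (N.sym e) (proj₂ (convolution-supp m a (Q⊆ a q))) })
               (a₀ ⁻¹ ∙ m , a₀ , q₀ , N.refl)
      ... | v , (a , q , e) , max = a , q , λ b q′ b≺a →
        max (b ⁻¹ ∙ m) (b , q′ , N.refl)
          (N.<-respˡ-≈ (N.trans (cancel b a) (N.sym e))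
            (N.<-respʳ-≈ (N.trans (N.∙-cong N.refl (swap b a)) (cancel a b))
              (∙-monoˡ-≺ (b ⁻¹ ∙ (a ⁻¹ ∙ m)) b≺a)))
        where
        cancel : ∀ b a → b ∙ (b ⁻¹ ∙ (a ⁻¹ ∙ m)) N.≈ a ⁻¹ ∙ m
        cancel b a = N.trans (N.sym (N.assoc _ _ _))
          (N.trans (N.∙-cong (N.inverseʳ b) N.refl) (N.identityˡ _))

        swap : ∀ b a → b ⁻¹ ∙ (a ⁻¹ ∙ m) N.≈ a ⁻¹ ∙ (b ⁻¹ ∙ m)
        swap b a = N.trans (N.sym (N.assoc _ _ _))
          (N.trans (N.∙-cong (N.comm _ _) N.refl) (N.assoc _ _ _))

    factor : ∀ m → ¬ sumOver (proj₁ (enumerateFactors m)) (convolution m) R.≈ 0# →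
             ∃ λ a → ∃ λ b → supp s a × supp t b × m N.≈ a ∙ b
    factor m nz with sumOver-nonzero N.setoid (proj₁ (enumerateFactors m)) (convolution m) nz
    ... | a , nz′ = a , a ⁻¹ ∙ m , proj₁ (convolution-supp m a nz′) , proj₂ (convolution-supp m a nz′) ,
      N.sym (N.trans (N.sym (N.assoc _ _ _)) (N.trans (N.∙-cong (N.inverseʳ a) N.refl) (N.identityˡ m)))

    infixl 7 _*_
    _*_ : Series
    _*_ = record
      { coeff       = λ m → sumOver (proj₁ (enumerateFactors m)) (convolution m)
      ; coeff-cong  = λ {m} {m′} e → sumOver-enumeration N.setoid (convolution-cong N.refl)
                        (λ _ → convolution-cong e N.refl) (enumerateFactors m) (enumerateFactors m′)
      ; small       = small-⊆ factor (small-∙ (small s) (small t))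
      ; wellOrdered = wellOrdered-⊆ factor (wellOrdered-∙ (wellOrdered s) (wellOrdered t))
      }

  _^_ : Series → ℕ → Series
  s ^ zero  = 1ₛ
  s ^ suc k = s ^ k * s

  Positive : Pred Series u
  Positive s = ∃ λ m → IsMax (supp s) m × 0# R.< coeff s m

  infix 4 _<_ _≤_ _≺ₛ_ _≼ₛ_

  _<_ _≤_ : Rel Series u
  s < t = Positive (t - s)
  s ≤ t = s < t ⊎ s ≈ t

  Nonzero : Pred Series u
  Nonzero s = ¬ s ≈ 0ₛ

  ∣_∣ : Series → Series
  ∣ s ∣ with em {Positive s}
  ... | yes _ = s
  ... | no _  = - s

  _≺ₛ_ _≼ₛ_ : Rel Series u
  s ≺ₛ t = ∀ r → 0# R.< r → r · ∣ s ∣ < ∣ t ∣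
  s ≼ₛ t = ¬ t ≺ₛ s

  𝕋⁺ 𝕋ˣ 𝕋∞ : Set (u ⊔ lsuc ℓ)
  𝕋⁺ = ∃ Positive
  𝕋ˣ = ∃ Nonzero
  𝕋∞ = ∃ λ s → ∀ r → const r < s

  infix 4 _≈∞_ _<∞_

  _≈∞_ _<∞_ : Rel 𝕋∞ u
  _≈∞_ = _≈_ on proj₁
  _<∞_ = _<_ on proj₁

  Constant : Pred Series u
  Constant s = ∃ λ r → s ≈ const r

  dominant : ∀ s → Nonzero s → ∃ (IsMax (supp s))
  dominant s s≉0 with em {∃ (supp s)}
  ... | yes e = wellOrdered⇒maxima (wellOrdered s) (supp s) (λ _ p → p) e
  ... | no ¬∃ = ⊥-elim (s≉0 λ m → zero-at m (coeff s m R.≟ 0#))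
    where
    zero-at : ∀ m → Dec (coeff s m R.≈ 0#) → coeff s m R.≈ 0#
    zero-at m (yes z) = z
    zero-at m (no nz) = ⊥-elim (¬∃ (m , nz))

  neg-pos : ∀ {a} → a R.< 0# → 0# R.< R.- a
  neg-pos {a} a<0 = R.<-respˡ-≈ (R.-‿inverseˡ a) (R.<-respʳ-≈ (R.+-identityʳ _) (R.+-monoʳ-< (R.- a) a<0))

  ∣∣-positive : ∀ s → Nonzero s → Positive ∣ s ∣
  ∣∣-positive s s≉0 with em {Positive s}
  ... | yes p = p
  ... | no ¬p with dominant s s≉0
  ...   | m , (m∈ , max) with R.compare 0# (coeff s m)
  ...     | tri< lt _ _ = ⊥-elim (¬p (m , (m∈ , max) , lt))
  ...     | tri≈ _ e _  = ⊥-elim (m∈ (R.sym e))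
  ...     | tri> _ _ gt = m , ((λ z → R.irrefl (R.sym z) (neg-pos gt)) ,
                               λ n nz → max n λ z → nz (R.trans (R.-‿cong z) R.-0≈0)) , neg-pos gt

  abs : 𝕋ˣ → 𝕋⁺
  abs (s , s≉0) = ∣ s ∣ , ∣∣-positive s s≉0

  monomial-self : ∀ m → coeff (monomial m) m R.≈ 1#
  monomial-self m with m N.≟ m
  ... | yes _ = R.refl
  ... | no ¬p = ⊥-elim (¬p N.refl)

  monomialˣ : N.Carrier → 𝕋ˣ
  monomialˣ m = monomial m , λ z →
    R.irrefl (R.trans (R.sym (z m)) (monomial-self m)) R.0<1

  monomial-only : ∀ {m n} → supp (monomial n) m → m N.≈ n
  monomial-only {m} {n} nz with m N.≟ n
  ... | yes p = p
  ... | no _  = ⊥-elim (nz R.refl)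

  monomial⁺ : N.Carrier → 𝕋⁺
  monomial⁺ m = monomial m , m ,
    ( (λ z → R.irrefl (R.trans (R.sym z) (monomial-self m)) R.0<1)
    , λ n n∈ m≺n → N.irrefl (N.sym (monomial-only n∈)) m≺n ) ,
    R.<-respʳ-≈ (R.sym (monomial-self m)) R.0<1

  *-positive : ∀ {s t} → Positive s → Positive t → Positive (s * t)
  *-positive {s} {t} (a , (a∈ , a-max) , 0<a) (b , (b∈ , b-max) , 0<b) =
    a ∙ b , ((λ z → R.irrefl (R.sym z) 0<ab) , ab-max) , 0<ab
    where
    f = convolution s t (a ∙ b)

    a\ab : a ⁻¹ ∙ (a ∙ b) N.≈ b
    a\ab = N.trans (N.sym (N.assoc _ _ _)) (N.trans (N.∙-cong (N.inverseˡ a) N.refl) (N.identityˡ b))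

    only-a : ∀ c → ¬ f c R.≈ 0# → c N.≈ a
    only-a c nz with N.compare c a | convolution-supp s t (a ∙ b) c nz
    ... | tri≈ _ e _  | _ = e
    ... | tri> _ _ gt | c∈ , _ = ⊥-elim (a-max c c∈ gt)
    ... | tri< lt _ _ | _ , d∈ = ⊥-elim (b-max _ d∈
      (N.<-respˡ-≈ c∙c\b (N.<-respʳ-≈ a∙c\b (∙-monoˡ-≺ (c ⁻¹ ∙ b) lt))))
      where
      c∙c\b : c ∙ (c ⁻¹ ∙ b) N.≈ b
      c∙c\b = N.trans (N.sym (N.assoc _ _ _)) (N.trans (N.∙-cong (N.inverseʳ c) N.refl) (N.identityˡ b))

      a∙c\b : a ∙ (c ⁻¹ ∙ b) N.≈ c ⁻¹ ∙ (a ∙ b)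
      a∙c\b = N.trans (N.sym (N.assoc _ _ _))
        (N.trans (N.∙-cong (N.comm a (c ⁻¹)) N.refl) (N.assoc _ _ _))

    singleton : Enumeration N.setoid (λ c → ¬ f c R.≈ 0#)
    singleton = a ∷ [] , [] ∷ [] , λ c nz → here (only-a c nz)

    value : coeff (s * t) (a ∙ b) R.≈ coeff s a R.* coeff t b
    value = R.trans
      (sumOver-enumeration N.setoid (convolution-cong s t N.refl) (λ _ → R.refl)
        (enumerateFactors s t (a ∙ b)) singleton)
      (R.trans (R.+-identityʳ _) (R.*-congˡ (coeff-cong t a\ab)))

    0<ab : 0# R.< coeff (s * t) (a ∙ b)
    0<ab = R.<-respʳ-≈ (R.sym value) (R.*-pos 0<a 0<b)

    ab-max : ∀ n → supp (s * t) n → n ≼ a ∙ b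
    ab-max n n∈ with factor s t n n∈
    ... | c , d , c∈ , d∈ , e = λ lt →
      ∙-mono-≼ (a-max c c∈) (b-max d d∈) (N.<-respʳ-≈ e lt)

  const-positive : ∀ {r} → 0# R.< r → Positive (const r)
  const-positive {r} 0<r = ε ,
    ( (λ z → R.irrefl (R.sym z) 0<c)
    , λ n n∈ ε≺n → N.irrefl (N.sym (monomial-only λ z → n∈ (R.trans (R.*-congˡ z) (R.zeroʳ r)))) ε≺n ) , 0<c
    where
    0<c : 0# R.< coeff (const r) ε
    0<c = R.*-pos 0<r (R.<-respʳ-≈ (R.sym (monomial-self ε)) R.0<1)

  const⁺ : ∃ (0# R.<_) → 𝕋⁺
  const⁺ (r , 0<r) = const r , const-positive 0<r

  𝐑⁺-rawMagma : RawMagma u u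
  𝐑⁺-rawMagma = record
    { Carrier = ∃ (0# R.<_)
    ; _≈_     = R._≈_ on proj₁
    ; _∙_     = λ (r , 0<r) (r′ , 0<r′) → r R.* r′ , R.*-pos 0<r 0<r′
    }

  𝐑-rawMagma : RawMagma u u
  𝐑-rawMagma = record { Carrier = R.Carrier ; _≈_ = R._≈_ ; _∙_ = R._+_ }

  𝕋⁺-rawMagma : RawMagma (u ⊔ lsuc ℓ) u
  𝕋⁺-rawMagma = record
    { Carrier = 𝕋⁺
    ; _≈_     = _≈_ on proj₁
    ; _∙_     = λ (s , p) (t , q) → s * t , *-positive {s} {t} p q
    }

  𝕋-rawMagma : RawMagma (u ⊔ lsuc ℓ) u
  𝕋-rawMagma = record { Carrier = Series ; _≈_ = _≈_ ; _∙_ = _+_ }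

  record Summable {i j} (I : Setoid i j) (s : Setoid.Carrier I → Series) :
                  Set (i ⊔ j ⊔ u ⊔ lsuc ℓ) where
    open Setoid I using () renaming (_≈_ to _≈ᵢ_)
    field
      family-cong       : ∀ {i j} → i ≈ᵢ j → s i ≈ s j
      union-small       : Small (λ m → ∃ λ i → supp (s i) m)
      union-wellOrdered : WellOrdered (λ m → ∃ λ i → supp (s i) m)
      -- The list may also contain indices at which the coefficient vanishes.
      finite            : ∀ m → Enumeration I (λ i → supp (s i) m)

  module _ {i j} (I : Setoid i j) (s : Setoid.Carrier I → Series) where

    ∑ : Summable I s → Series
    ∑ summable = record
      { coeff       = λ m → sumOver (proj₁ (finite m)) (λ i → coeff (s i) m)
      ; coeff-cong  = λ {m} {n} e → sumOver-enumeration I (λ i≈j → family-cong i≈j m)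
                        (λ i → coeff-cong (s i) e) (finite m) (finite n)
      ; small       = small-⊆ some union-small
      ; wellOrdered = wellOrdered-⊆ some union-wellOrdered
      }
      where
      open Summable summable

      some : ∀ m → ¬ sumOver (proj₁ (finite m)) (λ i → coeff (s i) m) R.≈ 0# → ∃ λ i → supp (s i) m
      some m = sumOver-nonzero I (proj₁ (finite m)) (λ i → coeff (s i) m)

    HasSum : Series → Set (i ⊔ j ⊔ u ⊔ lsuc ℓ)
    HasSum t = ∃ λ (summable : Summable I s) → t ≈ ∑ summable

  ℕ-setoid : Setoid _ _
  ℕ-setoid = ≡-setoid ℕ

  suppSetoid : Series → Setoid u u
  suppSetoid s = On.setoid {B = ∃ (supp s)} N.setoid proj₁

  record IsStronglyLinear (Φ : Series → Series) : Set (u ⊔ lsuc ℓ) where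
    field
      cong     : ∀ {s t} → s ≈ t → Φ s ≈ Φ t
      +-homo   : ∀ s t → Φ (s + t) ≈ Φ s + Φ t
      ·-homo   : ∀ r s → Φ (r · s) ≈ r · Φ s
      summable : ∀ (I : Setoid ℓ ℓ) s → Summable I s → Summable I (Φ ∘ s)
      ∑-homo   : ∀ (I : Setoid ℓ ℓ) s (p : Summable I s) →
                 Φ (∑ I s p) ≈ ∑ I (Φ ∘ s) (summable I s p)

  record IsExpClosedTransserialField (log : 𝕋⁺ → Series) : Set (u ⊔ lsuc ℓ) where
    field
      log-isomorphism : IsOrderedMagmaIsomorphism 𝕋⁺-rawMagma (_<_ on proj₁) 𝕋-rawMagma _<_ log
      log-monomial    : ∀ m n → supp (log (monomial⁺ m)) n → ε ≺ n
      log≤            : ∀ s → log s ≤ proj₁ s - 1ₛ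
      -- 1 + e is automatically positive.
      log-1+          : ∀ e → e ≺ₛ 1ₛ → (p : Positive (1ₛ + e)) →
                        HasSum ℕ-setoid (λ k → (R.sign k R.* R.recip k) · e ^ suc k) (log (1ₛ + e , p))
      log-const       : ∃ λ (log𝐑 : ∃ (0# R.<_) → R.Carrier) →
                        IsOrderedMagmaIsomorphism 𝐑⁺-rawMagma (R._<_ on proj₁) 𝐑-rawMagma R._<_ log𝐑 ×
                        (∀ r → log (const⁺ r) ≈ const (log𝐑 r))

  module Logarithm (log : 𝕋⁺ → Series) where
    infix 4 _≺≺_ _≼≼_

    log∣_∣ : 𝕋ˣ → Series
    log∣ s ∣ = log (abs s)

    _≺≺_ _≼≼_ : Rel 𝕋ˣ u
    s ≺≺ t = log∣ s ∣ ≺ₛ log∣ t ∣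
    s ≼≼ t = log∣ s ∣ ≼ₛ log∣ t ∣

    record IsFlatTransserialDerivation (∂ : Series → Series) (x : N.Carrier) : Set (u ⊔ lsuc ℓ) where
      field
        stronglyLinear : IsStronglyLinear ∂
        leibniz        : ∀ s t → ∂ (s * t) ≈ ∂ s * t + s * ∂ t
        -- ∂ (log |s|) = ∂ s / s
        ∂-log          : ∀ s → proj₁ s * ∂ log∣ s ∣ ≈ ∂ (proj₁ s)
        surjective     : ∀ t → ∃ λ s → ∂ s ≈ t
        x>0            : 0ₛ < monomial x
        x≉1            : ¬ x N.≈ ε
        ∂x≈1           : ∂ (monomial x) ≈ 1ₛ
        flat           : ∀ m n → supp (∂ (monomial m)) n → ∃ λ f → ∃ λ w →
                         monomialˣ f ≺≺ monomialˣ m × monomialˣ w ≼≼ monomialˣ x ×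
                         n N.≈ m ∙ f ∙ w

    record IsFlatCompositionLaw (_∘ₛ_ : Series → 𝕋∞ → Series) (x : N.Carrier) : Set (u ⊔ lsuc ℓ) where
      field
        ∘-congʳ        : ∀ f {s t} → s ≈∞ t → f ∘ₛ s ≈ f ∘ₛ t
        stronglyLinear : ∀ s → IsStronglyLinear (_∘ₛ s)
        *-homo         : ∀ s f g → (f * g) ∘ₛ s ≈ (f ∘ₛ s) * (g ∘ₛ s)
        1-homo         : ∀ s → 1ₛ ∘ₛ s ≈ 1ₛ
        <-mono         : ∀ s {f g} → f < g → f ∘ₛ s < g ∘ₛ s
        -- f ∘ₛ s is automatically positive.
        log-homo       : ∀ s f (p : Positive f) (q : Positive (f ∘ₛ s)) →
                         log (f , p) ∘ₛ s ≈ log (f ∘ₛ s , q)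
        -- 𝕋∞, being a group under composition with unit x, contains s ∘ₛ t and x;
        -- this is needed to state associativity and the right unit law.
        infinite       : ∀ (s t : 𝕋∞) r → const r < proj₁ s ∘ₛ t
        x-infinite     : ∀ r → const r < monomial x

      _⊚_ : 𝕋∞ → 𝕋∞ → 𝕋∞
      s ⊚ t = proj₁ s ∘ₛ t , infinite s t

      x∞ : 𝕋∞
      x∞ = monomial x , x-infinite

      field
        assoc          : ∀ f s t → f ∘ₛ (s ⊚ t) ≈ (f ∘ₛ s) ∘ₛ t
        identityˡ      : ∀ s → monomial x ∘ₛ s ≈ proj₁ s
        identityʳ      : ∀ f → f ∘ₛ x∞ ≈ f
        flat           : ∀ (s : 𝕋∞) m → ¬ m N.≈ ε → ∀ n → supp (monomial m ∘ₛ s) n →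
                         ∃ λ 𝔡 → IsMax (supp (monomial m ∘ₛ s)) 𝔡 ×
                         ∃ λ f → ∃ λ w → ∃ λ v → supp (proj₁ s) v ×
                         monomialˣ f ≺≺ monomialˣ m × w ≼ ε × monomialˣ w ≼≼ monomialˣ v ×
                         n N.≈ 𝔡 ∙ f ∙ w

  record IsHField (∂ : Series → Series) : Set (u ⊔ lsuc ℓ) where
    field
      kernel   : ∀ f → ∂ f ≈ 0ₛ ⇔ Constant f
      ∂-pos    : ∀ (f : 𝕋∞) → 0ₛ < ∂ (proj₁ f)

  iterate : (Series → Series) → ℕ → Series → Series
  iterate ∂ zero    f = f
  iterate ∂ (suc k) f = ∂ (iterate ∂ k f)

  record TaylorExpansion (∂ : Series → Series) (_∘ₛ_ : Series → 𝕋∞ → Series)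
                         (f : Series) (s : 𝕋∞) (δ : Series)
                         (s+δ-infinite : ∀ r → const r < proj₁ s + δ) : Set (u ⊔ lsuc ℓ) where
    term : Series → ℕ → Series
    term g k = (iterate ∂ k g ∘ₛ s) * δ ^ k

    field
      summable   : Summable (×-setoid (suppSetoid f) ℕ-setoid) (λ ((m , _) , k) → term (monomial m) k)
      expansion₁ : HasSum ℕ-setoid (λ k → R.recip! k · term f k) (f ∘ₛ (proj₁ s + δ , s+δ-infinite))
      expansion₂ : HasSum (×-setoid (suppSetoid f) ℕ-setoid)
                     (λ ((m , _) , k) → (coeff f m R.* R.recip! k) · term (monomial m) k)
                     (f ∘ₛ (proj₁ s + δ , s+δ-infinite))
      decreasing : ∀ k → Nonzero (term f k) → term f (suc k) ≺ₛ term f k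

  record TransserialStructure : Set (u ⊔ lsuc ℓ) where
    field
      log  : 𝕋⁺ → Series
      ∂    : Series → Series
      _∘ₛ_ : Series → 𝕋∞ → Series
      x    : N.Carrier

    open Logarithm log using (IsFlatTransserialDerivation; IsFlatCompositionLaw)

    field
      isExpClosedTransserialField : IsExpClosedTransserialField log
      isFlatTransserialDerivation : IsFlatTransserialDerivation ∂ x
      isHField                    : IsHField ∂
      isFlatCompositionLaw        : IsFlatCompositionLaw _∘ₛ_ x

    open IsFlatCompositionLaw isFlatCompositionLaw using (_⊚_; x∞) public

    field
      chainRule  : ∀ f (s : 𝕋∞) → ∂ (f ∘ₛ s) ≈ ∂ (proj₁ s) * (∂ f ∘ₛ s)
      -- s + δ is automatically infinite, since δ ≺ₛ s.
      taylor     : ∀ f (s : 𝕋∞) δ → δ ≺ₛ proj₁ s →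
                   (∀ m → supp f m → (∂ (monomial m) ∘ₛ s) * δ ≺ₛ monomial m ∘ₛ s) →
                   (s+δ-infinite : ∀ r → const r < proj₁ s + δ) →
                   TaylorExpansion ∂ _∘ₛ_ f s δ s+δ-infinite
      _⁻¹∞       : 𝕋∞ → 𝕋∞
      isGroup    : IsGroup _≈∞_ _⊚_ x∞ _⁻¹∞
      increasing : ∀ f → ¬ Constant f → 0ₛ < ∂ f →
                   ∀ {s t : 𝕋∞} → s <∞ t → f ∘ₛ s < f ∘ₛ t
      decreasing : ∀ f → ¬ Constant f → ∂ f < 0ₛ →
                   ∀ {s t : 𝕋∞} → s <∞ t → f ∘ₛ t < f ∘ₛ s

    𝕋∞-group : Group (u ⊔ lsuc ℓ) u
    𝕋∞-group = record { isGroup = isGroup }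

    centralizer : 𝕋∞ → Group (u ⊔ lsuc ℓ) u
    centralizer = Centralizer 𝕋∞-group

{-# OPTIONS --safe #-}
module Submission where

-- Translations x + r compose additively and are ordered like the constants r,
-- so r ↦ x + r embeds (𝐑, +, <) in the group of infinite series. The theorem
-- comes down to the fact that the image of this embedding is the whole
-- centralizer of x + a, for every a ≠ 0 (centralizer-translation). Indeed, if h
-- commutes with x + a, then h ∘ (x + a) = h + a, and the chain rule gives
-- h′ ∘ (x + a) = h′ = h′ ∘ x. By monotonicity, s ↦ k ∘ s is injective for every
-- nonconstant k, and x + a ≠ x, so h′ is a constant c. Since c x also has
-- derivative c and the kernel of the derivation is 𝐑, h = c x + r for some r;
-- comparing h ∘ (x + a) = c x + c a + r with h + a = c x + r + a gives c = 1.
--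
-- Every f ≠ x is conjugate to such a translation (conjugate-to-translation): to
-- x + 1 if f > x, and to x - 1 if f < x, as then f⁻¹ > x is conjugate to x + 1.
-- In a bi-ordered group conjugation is an automorphism of ordered groups, so it
-- carries the centralizer of f isomorphically onto that of the translation
-- (CentralizerOfConjugate).

open import Defs
open import Algebra.Bundles using (Group; CommutativeRing)
import Algebra.Properties.CommutativeSemigroup as CommutativeSemigroupProperties
import Algebra.Properties.Group as GroupProperties
import Algebra.Properties.Ring as RingProperties
open import Axiom.ExcludedMiddle using (ExcludedMiddle)
open import Data.Empty using (⊥-elim)
open import Data.List.Base using ([]; _∷_)
open import Data.List.Relation.Unary.All using ([])
open import Data.List.Relation.Unary.AllPairs using ([]; _∷_)
open import Data.List.Relation.Unary.Any using (here)
open import Data.Product using (∃; _×_; _,_; proj₁; proj₂)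
open import Data.Sum.Base using (_⊎_; inj₁; inj₂)
open import Function.Base using (_on_)
open import Function.Bundles using (_⇔_; mk⇔; module Equivalence)
open import Level using (Level; _⊔_) renaming (suc to lsuc)
open import Relation.Binary.Bundles using (Setoid)
open import Relation.Binary.Core using (Rel)
open import Relation.Binary.Definitions using (_Respects₂_; tri<; tri≈; tri>)
open import Relation.Binary.Morphism.Structures using (IsOrderMonomorphism)
import Relation.Binary.Reasoning.Setoid as SetoidReasoning
open import Relation.Nullary.Decidable.Core using (yes; no)
open import Relation.Nullary.Negation.Core using (¬_)

-- Conjugation in a group

module Conjugation {a ℓ : Level} (G : Group a ℓ) where
  open Group G
  open GroupProperties G
  open SetoidReasoning setoid

  -- The conjugate of g by h, with h acting on the left.
  conj : Carrier → Carrier → Carrier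
  conj h g = h ∙ g ∙ h ⁻¹

  conj-cong : ∀ h {g k} → g ≈ k → conj h g ≈ conj h k
  conj-cong h e = ∙-congʳ (∙-congˡ e)

  conj-homo : ∀ h g k → conj h (g ∙ k) ≈ conj h g ∙ conj h k
  conj-homo h g k = begin
    h ∙ (g ∙ k) ∙ h ⁻¹                ≈⟨ ∙-congʳ (assoc h g k) ⟨
    h ∙ g ∙ k ∙ h ⁻¹                  ≈⟨ ∙-congʳ (∙-congʳ (//-rightDividesˡ h (h ∙ g))) ⟨
    conj h g ∙ h ∙ k ∙ h ⁻¹           ≈⟨ ∙-congʳ (assoc (conj h g) h k) ⟩
    conj h g ∙ (h ∙ k) ∙ h ⁻¹         ≈⟨ assoc (conj h g) (h ∙ k) (h ⁻¹) ⟩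
    conj h g ∙ conj h k               ∎

  conj-inverseʳ : ∀ h g → conj h (conj (h ⁻¹) g) ≈ g
  conj-inverseʳ h g = begin
    h ∙ (h ⁻¹ ∙ g ∙ h ⁻¹ ⁻¹) ∙ h ⁻¹   ≈⟨ ∙-congʳ (∙-congˡ (∙-congˡ (⁻¹-involutive h))) ⟩
    h ∙ (h ⁻¹ ∙ g ∙ h) ∙ h ⁻¹         ≈⟨ ∙-congʳ (∙-congˡ (assoc (h ⁻¹) g h)) ⟩
    h ∙ (h ⁻¹ ∙ (g ∙ h)) ∙ h ⁻¹       ≈⟨ ∙-congʳ (\\-leftDividesˡ h (g ∙ h)) ⟩
    g ∙ h ∙ h ⁻¹                      ≈⟨ //-rightDividesʳ h g ⟩
    g                                 ∎

  conj-inverseˡ : ∀ h g → conj (h ⁻¹) (conj h g) ≈ g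
  conj-inverseˡ h g = begin
    h ⁻¹ ∙ (h ∙ g ∙ h ⁻¹) ∙ h ⁻¹ ⁻¹   ≈⟨ ∙-congʳ (∙-congˡ (assoc h g (h ⁻¹))) ⟩
    h ⁻¹ ∙ (h ∙ (g ∙ h ⁻¹)) ∙ h ⁻¹ ⁻¹ ≈⟨ ∙-congʳ (\\-leftDividesʳ h (g ∙ h ⁻¹)) ⟩
    g ∙ h ⁻¹ ∙ h ⁻¹ ⁻¹                ≈⟨ //-rightDividesʳ (h ⁻¹) g ⟩
    g                                 ∎

  conj-injective : ∀ h {g k} → conj h g ≈ conj h k → g ≈ k
  conj-injective h {g} {k} e = begin
    g                       ≈⟨ conj-inverseˡ h g ⟨
    conj (h ⁻¹) (conj h g)  ≈⟨ conj-cong (h ⁻¹) e ⟩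
    conj (h ⁻¹) (conj h k)  ≈⟨ conj-inverseˡ h k ⟩
    k                       ∎

  conj-commute : ∀ h {g k} → g ∙ k ≈ k ∙ g → conj h g ∙ conj h k ≈ conj h k ∙ conj h g
  conj-commute h {g} {k} e = begin
    conj h g ∙ conj h k  ≈⟨ conj-homo h g k ⟨
    conj h (g ∙ k)       ≈⟨ conj-cong h e ⟩
    conj h (k ∙ g)       ≈⟨ conj-homo h k g ⟩
    conj h k ∙ conj h g  ∎

  -- The equation h ∙ f ≈ t ∙ h is the form in which conjugacy of f and t is given.
  intertwine⇒conj : ∀ {h f t} → h ∙ f ≈ t ∙ h → conj h f ≈ t
  intertwine⇒conj {h} {f} {t} e = trans (∙-congʳ e) (//-rightDividesʳ h t)

  intertwine-⁻¹ : ∀ {h f t} → h ∙ f ⁻¹ ≈ t ∙ h → h ∙ f ≈ t ⁻¹ ∙ h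
  intertwine-⁻¹ {h} {f} {t} e = begin
    h ∙ f                       ≈⟨ ∙-congʳ (\\-leftDividesʳ t h) ⟨
    t ⁻¹ ∙ (t ∙ h) ∙ f          ≈⟨ ∙-congʳ (∙-congˡ e) ⟨
    t ⁻¹ ∙ (h ∙ f ⁻¹) ∙ f       ≈⟨ assoc (t ⁻¹) (h ∙ f ⁻¹) f ⟩
    t ⁻¹ ∙ (h ∙ f ⁻¹ ∙ f)       ≈⟨ ∙-congˡ (trans (assoc h (f ⁻¹) f) (trans (∙-congˡ (inverseˡ f)) (identityʳ h))) ⟩
    t ⁻¹ ∙ h                    ∎

-- Centralizers of conjugate elements in a bi-ordered group

-- Let G be a bi-ordered group and τ an embedding of ordered groups of A into G
-- whose image is the centralizer of t. If h conjugates f to t, then conjugation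
-- by h carries the centralizer of f onto the image of τ, so that it is
-- isomorphic to A.
module CentralizerOfConjugate
  {a ℓ₁ ℓ₂ b ℓ₃ ℓ₄ : Level}
  (G : Group a ℓ₁) (_<_ : Rel (Group.Carrier G) ℓ₂)
  (A : Group b ℓ₃) (_<ᴬ_ : Rel (Group.Carrier A) ℓ₄)
  where

  open Group G
  open Conjugation G
  open SetoidReasoning setoid
  private
    module A = Group A
    module AP = GroupProperties A

  module Isomorphism
    (<-resp-≈ : _<_ Respects₂ _≈_)
    (∙-monoˡ-< : ∀ k {g h} → g < h → (k ∙ g) < (k ∙ h))
    (∙-monoʳ-< : ∀ k {g h} → g < h → (g ∙ k) < (h ∙ k))
    (τ : A.Carrier → Carrier)
    (τ-embedding : IsOrderMonomorphism A._≈_ _≈_ _<ᴬ_ _<_ τ)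
    (τ-homo : ∀ r s → τ (r A.∙ s) ≈ τ r ∙ τ s)
    {t : Carrier}
    (centralizer-t : ∀ g → g ∙ t ≈ t ∙ g ⇔ (∃ λ r → g ≈ τ r))
    {h f : Carrier} (h∙f≈t∙h : h ∙ f ≈ t ∙ h)
    where

    private
      module C = Group (Centralizer G f)
      module τ = IsOrderMonomorphism τ-embedding

    <-resp : ∀ {g g′ k k′} → g ≈ g′ → k ≈ k′ → g < k → g′ < k′
    <-resp g≈ k≈ lt = proj₁ <-resp-≈ k≈ (proj₂ <-resp-≈ g≈ lt)

    conj-mono : ∀ k {g g′} → g < g′ → conj k g < conj k g′
    conj-mono k g<g′ = ∙-monoʳ-< (k ⁻¹) (∙-monoˡ-< k g<g′)

    conj-cancel : ∀ k {g g′} → conj k g < conj k g′ → g < g′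
    conj-cancel k {g} {g′} lt = <-resp (conj-inverseˡ k g) (conj-inverseˡ k g′) (conj-mono (k ⁻¹) lt)

    conj-centralizes : ∀ {g} → g ∙ f ≈ f ∙ g → conj h g ∙ t ≈ t ∙ conj h g
    conj-centralizes {g} p = begin
      conj h g ∙ t         ≈⟨ ∙-congˡ (intertwine⇒conj h∙f≈t∙h) ⟨
      conj h g ∙ conj h f  ≈⟨ conj-commute h p ⟩
      conj h f ∙ conj h g  ≈⟨ ∙-congʳ (intertwine⇒conj h∙f≈t∙h) ⟩
      t ∙ conj h g         ∎

    -- The r for which conjugation by h maps g to τ r.
    coordinate : ∀ (g : C.Carrier) → ∃ λ r → conj h (proj₁ g) ≈ τ r
    coordinate (g , p) = Equivalence.to (centralizer-t (conj h g)) (conj-centralizes p)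

    -- The isomorphism: τ ∘ φ is conjugation by h, so that every property of φ is
    -- inherited from conjugation and from τ.
    φ : C.Carrier → A.Carrier
    φ g = proj₁ (coordinate g)

    τφ : ∀ g → conj h (proj₁ g) ≈ τ (φ g)
    τφ g = proj₂ (coordinate g)

    φ-unique : ∀ g {r} → conj h (proj₁ g) ≈ τ r → φ g A.≈ r
    φ-unique g e = τ.injective (trans (sym (τφ g)) e)

    φ-cong : ∀ {g k} → g C.≈ k → φ g A.≈ φ k
    φ-cong {g} {k} e = φ-unique g (trans (conj-cong h e) (τφ k))

    φ-homo : ∀ g k → φ (g C.∙ k) A.≈ φ g A.∙ φ k
    φ-homo g k = φ-unique (g C.∙ k) (begin
      conj h (proj₁ g ∙ proj₁ k)             ≈⟨ conj-homo h _ _ ⟩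
      conj h (proj₁ g) ∙ conj h (proj₁ k)    ≈⟨ ∙-cong (τφ g) (τφ k) ⟩
      τ (φ g) ∙ τ (φ k)                      ≈⟨ τ-homo (φ g) (φ k) ⟨
      τ (φ g A.∙ φ k)                        ∎)

    φ-ε : φ C.ε A.≈ A.ε
    φ-ε = AP.identityʳ-unique (φ C.ε) (φ C.ε)
      (A.trans (A.sym (φ-homo C.ε C.ε)) (φ-cong (C.identityˡ C.ε)))

    φ-⁻¹ : ∀ g → φ (g C.⁻¹) A.≈ φ g A.⁻¹
    φ-⁻¹ g = AP.inverseˡ-unique (φ (g C.⁻¹)) (φ g)
      (A.trans (A.sym (φ-homo (g C.⁻¹) g)) (A.trans (φ-cong (C.inverseˡ g)) φ-ε))

    φ-injective : ∀ {g k} → φ g A.≈ φ k → g C.≈ k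
    φ-injective {g} {k} e = conj-injective h (trans (τφ g) (trans (τ.cong e) (sym (τφ k))))

    φ-surjective : ∀ r → ∃ λ g → ∀ {k} → k C.≈ g → φ k A.≈ r
    φ-surjective r = (conj (h ⁻¹) (τ r) , commutes) ,
      λ {k} e → φ-unique k (trans (conj-cong h e) (conj-inverseʳ h (τ r)))
      where
      f≈ : conj (h ⁻¹) t ≈ f
      f≈ = trans (conj-cong (h ⁻¹) (sym (intertwine⇒conj h∙f≈t∙h))) (conj-inverseˡ h f)

      commutes : conj (h ⁻¹) (τ r) ∙ f ≈ f ∙ conj (h ⁻¹) (τ r)
      commutes = begin
        conj (h ⁻¹) (τ r) ∙ f                 ≈⟨ ∙-congˡ f≈ ⟨
        conj (h ⁻¹) (τ r) ∙ conj (h ⁻¹) t     ≈⟨ conj-commute (h ⁻¹) (Equivalence.from (centralizer-t (τ r)) (r , refl)) ⟩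
        conj (h ⁻¹) t ∙ conj (h ⁻¹) (τ r)     ≈⟨ ∙-congʳ f≈ ⟩
        f ∙ conj (h ⁻¹) (τ r)                 ∎

    φ-mono : ∀ {g k} → proj₁ g < proj₁ k → φ g <ᴬ φ k
    φ-mono {g} {k} lt = τ.cancel (<-resp (τφ g) (τφ k) (conj-mono h lt))

    φ-cancel : ∀ {g k} → φ g <ᴬ φ k → proj₁ g < proj₁ k
    φ-cancel {g} {k} lt = conj-cancel h (<-resp (sym (τφ g)) (sym (τφ k)) (τ.mono lt))

    centralizer≅ : ∃ λ φ → IsOrderedGroupIsomorphism
                     (Group.rawGroup (Centralizer G f)) (_<_ on proj₁) A.rawGroup _<ᴬ_ φ
    centralizer≅ = φ , record
      { isGroupIsomorphism = record
        { isGroupMonomorphism = record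
          { isGroupHomomorphism = record
            { isMonoidHomomorphism = record
              { isMagmaHomomorphism = record
                { isRelHomomorphism = record { cong = λ {g} {k} → φ-cong {g} {k} }
                ; homo              = φ-homo
                }
              ; ε-homo = φ-ε
              }
            ; ⁻¹-homo = φ-⁻¹
            }
          ; injective = λ {g} {k} → φ-injective {g} {k}
          }
        ; surjective = φ-surjective
        }
      ; isOrderIsomorphism = record
        { isOrderMonomorphism = record
          { isOrderHomomorphism = record
            { cong = λ {g} {k} → φ-cong {g} {k}
            ; mono = λ {g} {k} → φ-mono {g} {k}
            }
          ; injective = λ {g} {k} → φ-injective {g} {k}
          ; cancel    = λ {g} {k} → φ-cancel {g} {k}
          }
        ; surjective = φ-surjective
        }
      }

-- Identities in commutative rings

module RingIdentities {c ℓ : Level} (R : CommutativeRing c ℓ) where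
  open CommutativeRing R hiding (zero)
  open RingProperties ring
  open CommutativeSemigroupProperties +-commutativeSemigroup using (interchange)
  open SetoidReasoning setoid

  -- The next two identities are read coefficientwise: x, a d and r d stand for the
  -- coefficients of the series x and of the constants a and r, and d for that of 1.
  x-[r-a]d≈x+ad-rd : ∀ x r a d → x + - ((r + - a) * d) ≈ (x + a * d) + - (r * d)
  x-[r-a]d≈x+ad-rd x r a d = begin
    x + - ((r + - a) * d)      ≈⟨ +-congˡ (-‿distribˡ-* _ _) ⟩
    x + - (r + - a) * d        ≈⟨ +-congˡ (*-congʳ (⁻¹-anti-homo‿- r a)) ⟩
    x + (a + - r) * d          ≈⟨ +-congˡ ([y-z]x≈yx-zx d a r) ⟩
    x + (a * d + - (r * d))    ≈⟨ +-assoc _ _ _ ⟨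
    (x + a * d) + - (r * d)    ∎

  [x+ad]-[x+rd]≈[a-r]d : ∀ x r a d → (x + a * d) + - (x + r * d) ≈ (a + - r) * d
  [x+ad]-[x+rd]≈[a-r]d x r a d = begin
    (x + a * d) + - (x + r * d)      ≈⟨ +-congˡ (-‿+-comm x (r * d)) ⟨
    (x + a * d) + (- x + - (r * d))  ≈⟨ interchange _ _ _ _ ⟩
    (x + - x) + (a * d + - (r * d))  ≈⟨ +-congʳ (-‿inverseʳ x) ⟩
    0# + (a * d + - (r * d))         ≈⟨ +-identityˡ _ ⟩
    a * d + - (r * d)                ≈⟨ [y-z]x≈yx-zx d a r ⟨
    (a + - r) * d                    ∎

  f-cx≈r⇒f≈cx+r : ∀ f c x r → f + - c * x ≈ r → f ≈ c * x + r
  f-cx≈r⇒f≈cx+r f c x r e = begin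
    f                         ≈⟨ //-rightDividesˡ (c * x) f ⟨
    (f + - (c * x)) + c * x   ≈⟨ +-congʳ (+-congˡ (-‿distribˡ-* c x)) ⟩
    (f + - c * x) + c * x     ≈⟨ +-congʳ e ⟩
    r + c * x                 ≈⟨ +-comm r (c * x) ⟩
    c * x + r                 ∎

  cx+ca≈cx+a⇒ca≈a : ∀ c x a b → c * (x + a) + b ≈ (c * x + b) + a → c * a ≈ a
  cx+ca≈cx+a⇒ca≈a c x a b e = +-cancelˡ (c * x + b) (c * a) a (begin
    (c * x + b) + c * a   ≈⟨ +-assoc _ _ _ ⟩
    c * x + (b + c * a)   ≈⟨ +-congˡ (+-comm b (c * a)) ⟩
    c * x + (c * a + b)   ≈⟨ +-assoc _ _ _ ⟨
    (c * x + c * a) + b   ≈⟨ +-congʳ (distribˡ c x a) ⟨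
    c * (x + a) + b       ≈⟨ e ⟩
    (c * x + b) + a       ∎)

  ca≈a⇒c≈1 : ∀ {a b c} → a * b ≈ 1# → c * a ≈ a → c ≈ 1#
  ca≈a⇒c≈1 {a} {b} {c} ab≈1 ca≈a = begin
    c            ≈⟨ *-identityʳ c ⟨
    c * 1#       ≈⟨ *-congˡ ab≈1 ⟨
    c * (a * b)  ≈⟨ *-assoc c a b ⟨
    c * a * b    ≈⟨ *-congʳ ca≈a ⟩
    a * b        ≈⟨ ab≈1 ⟩
    1#           ∎

-- Order, constants and unit of the field of series

module SeriesProperties {u : Level} (ℓ : Level) (em : ExcludedMiddle u)
                        (𝐑 : OrderedField u) (𝔑 : OrderedAbelianGroup u) where
  open WellBased ℓ em 𝐑 𝔑
  open Series
  open R using (0#; 1#)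
  open CommutativeRing R.commutativeRing using (*-identityˡ; *-identityʳ)
  open RingProperties R.ring using (x∙y⁻¹≈ε⇒x≈y; x≈y⇒x∙y⁻¹≈ε; ⁻¹-anti-homo‿-)

  series-setoid : Setoid (u ⊔ lsuc ℓ) u
  series-setoid = record
    { Carrier       = Series
    ; _≈_           = _≈_
    ; isEquivalence = record
      { refl  = λ m → R.refl
      ; sym   = λ e m → R.sym (e m)
      ; trans = λ e e′ m → R.trans (e m) (e′ m)
      }
    }

  -- Equality of series unfolds to a pointwise statement from which the series
  -- cannot be inferred; hence the explicit series arguments.
  positive-cong : ∀ s t → s ≈ t → Positive s → Positive t
  positive-cong s t e (m , (m∈ , max) , 0<sm) =
    m , ((λ z → m∈ (R.trans (e m) z)) , λ n n∈ → max n λ z → n∈ (R.trans (R.sym (e n)) z)) ,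
    R.<-respʳ-≈ (e m) 0<sm

  positive-or-negative : ∀ s → Nonzero s → Positive s ⊎ Positive (- s)
  positive-or-negative s s≉0 with dominant s s≉0
  ... | m , (m∈ , max) with R.compare 0# (coeff s m)
  ...   | tri< 0<sm _ _ = inj₁ (m , (m∈ , max) , 0<sm)
  ...   | tri≈ _ 0≈sm _ = ⊥-elim (m∈ (R.sym 0≈sm))
  ...   | tri> _ _ sm<0 = inj₂ (m , ((λ z → R.irrefl (R.sym z) (neg-pos sm<0)) , -max) , neg-pos sm<0)
    where
    -max : ∀ n → supp (- s) n → n N.≼ m
    -max n n∈ = max n λ z → n∈ (R.trans (R.-‿cong z) R.-0≈0)

  <-resp-≈ : _<_ Respects₂ _≈_
  <-resp-≈ =
    (λ {s} {t} {t′} t≈t′ → positive-cong (t - s) (t′ - s) λ m → R.+-congʳ (t≈t′ m)) ,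
    (λ {t} {s} {s′} s≈s′ → positive-cong (t - s) (t - s′) λ m → R.+-congˡ (R.-‿cong (s≈s′ m)))

  <⇒≉ : ∀ s t → s < t → ¬ s ≈ t
  <⇒≉ s t (m , (m∈ , _) , _) s≈t = m∈ (x≈y⇒x∙y⁻¹≈ε (R.sym (s≈t m)))

  ≉⇒<∨> : ∀ s t → ¬ s ≈ t → s < t ⊎ t < s
  ≉⇒<∨> s t s≉t with positive-or-negative (t - s) (λ z → s≉t λ m → R.sym (x∙y⁻¹≈ε⇒x≈y _ _ (z m)))
  ... | inj₁ p = inj₁ p
  ... | inj₂ p = inj₂ (positive-cong (- (t - s)) (s - t) (λ m → ⁻¹-anti-homo‿- (coeff t m) (coeff s m)) p)

  const-ε : ∀ r → coeff (const r) N.ε R.≈ r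
  const-ε r = R.trans (R.*-congˡ (monomial-self N.ε)) (*-identityʳ r)

  const-positive⁻¹ : ∀ r → Positive (const r) → 0# R.< r
  const-positive⁻¹ r (m , (m∈ , _) , 0<cm) =
    R.<-respʳ-≈ (R.trans (coeff-cong (const r) m≈ε) (const-ε r)) 0<cm
    where
    m≈ε : m N.≈ N.ε
    m≈ε = monomial-only λ z → m∈ (R.trans (R.*-congˡ z) (R.zeroʳ r))

  infinite⇒nonconstant : (f : 𝕋∞) → ¬ Constant (proj₁ f)
  infinite⇒nonconstant (f , const<f) (r , f≈r) =
    <⇒≉ (const r) f (const<f r) λ m → R.sym (f≈r m)

  -- Only the factorization m = ε ∙ m contributes to the coefficient of m in s * t.
  unit-* : ∀ s t → s ≈ 1ₛ → s * t ≈ t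
  unit-* s t s≈1 m = R.trans
    (sumOver-enumeration N.setoid (convolution-cong s t N.refl) (λ _ → R.refl)
      (enumerateFactors s t m) singleton)
    (R.trans (R.+-identityʳ _) (R.trans (R.*-cong (R.trans (s≈1 N.ε) (monomial-self N.ε)) (coeff-cong t ε\m)) (*-identityˡ _)))
    where
    ε\m : N.ε N.⁻¹ N.∙ m N.≈ m
    ε\m = N.trans (N.∙-cong (N.trans (N.sym (N.identityʳ _)) (N.inverseˡ N.ε)) N.refl) (N.identityˡ m)

    singleton : Enumeration N.setoid (λ a → ¬ convolution s t m a R.≈ 0#)
    singleton = N.ε ∷ [] , [] ∷ [] , λ a nz → here (monomial-only λ z →
      proj₁ (convolution-supp s t m a nz) (R.trans (s≈1 a) z))

-- Translations and their centralizers

module Translations {u : Level} (ℓ : Level) (em : ExcludedMiddle u)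
                    (𝐑 : OrderedField u) (𝔑 : OrderedAbelianGroup u)
                    (T : WellBased.TransserialStructure ℓ em 𝐑 𝔑) where
  open WellBased ℓ em 𝐑 𝔑
  open TransserialStructure T
  open Series
  open R using (0#; 1#)
  open CommutativeRing R.commutativeRing using (*-identityˡ; distribʳ)
  open RingIdentities R.commutativeRing
  open RingProperties R.ring using (-‿injective; +-cancelˡ; -‿distribˡ-*; xyx⁻¹≈y)
  open SeriesProperties ℓ em 𝐑 𝔑
  open SetoidReasoning series-setoid
  open IsHField isHField
  open Logarithm log using (module IsFlatTransserialDerivation; module IsFlatCompositionLaw)
  private
    module D = IsFlatTransserialDerivation isFlatTransserialDerivation
    module ∂ = IsStronglyLinear D.stronglyLinear
    module C = IsFlatCompositionLaw isFlatCompositionLaw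
    module G = Group 𝕋∞-group

  -- The series x + a. It exceeds every constant r because x exceeds r - a.
  translation : R.Carrier → 𝕋∞
  translation a = monomial x + const a , λ r →
    positive-cong (monomial x - const (r R.+ R.- a)) (monomial x + const a - const r)
      (λ m → x-[r-a]d≈x+ad-rd (coeff (monomial x) m) r a (coeff 1ₛ m))
      (C.x-infinite (r R.+ R.- a))

  const-∘ : ∀ r s → const r ∘ₛ s ≈ const r
  const-∘ r s = begin
    (r · 1ₛ) ∘ₛ s    ≈⟨ IsStronglyLinear.·-homo (C.stronglyLinear s) r 1ₛ ⟩
    r · (1ₛ ∘ₛ s)    ≈⟨ (λ m → R.*-congˡ (C.1-homo s m)) ⟩
    r · 1ₛ           ∎

  translation-⊚ : ∀ a h → proj₁ (translation a ⊚ h) ≈ proj₁ h + const a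
  translation-⊚ a h = begin
    (monomial x + const a) ∘ₛ h           ≈⟨ IsStronglyLinear.+-homo (C.stronglyLinear h) (monomial x) (const a) ⟩
    (monomial x ∘ₛ h) + (const a ∘ₛ h)    ≈⟨ (λ m → R.+-cong (C.identityˡ h m) (const-∘ a h m)) ⟩
    proj₁ h + const a                     ∎

  translation-homo : ∀ r s → translation (r R.+ s) ≈∞ translation r ⊚ translation s
  translation-homo r s = begin
    monomial x + const (r R.+ s)          ≈⟨ (λ m → lemma (coeff (monomial x) m) r s (coeff 1ₛ m)) ⟩
    (monomial x + const s) + const r      ≈⟨ translation-⊚ r (translation s) ⟨
    proj₁ (translation r ⊚ translation s) ∎
    where
    lemma : ∀ x r s d → x R.+ (r R.+ s) R.* d R.≈ (x R.+ s R.* d) R.+ r R.* d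
    lemma x r s d = R.trans (R.+-congˡ (R.trans (distribʳ d r s) (R.+-comm _ _))) (R.sym (R.+-assoc _ _ _))

  translation-cong : ∀ {r s} → r R.≈ s → translation r ≈∞ translation s
  translation-cong e m = R.+-congˡ (R.*-congʳ e)

  translation-difference : ∀ r s → proj₁ (translation s) - proj₁ (translation r) ≈ const (s R.+ R.- r)
  translation-difference r s m = [x+ad]-[x+rd]≈[a-r]d (coeff (monomial x) m) r s (coeff 1ₛ m)

  translation-embedding : IsOrderMonomorphism R._≈_ _≈∞_ R._<_ _<∞_ translation
  translation-embedding = record
    { isOrderHomomorphism = record { cong = translation-cong ; mono = mono }
    ; injective = injective
    ; cancel    = cancel
    }
    where
    mono : ∀ {r s} → r R.< s → translation r <∞ translation s
    mono {r} {s} r<s = positive-cong (const (s R.+ R.- r)) (proj₁ (translation s) - proj₁ (translation r))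
      (λ m → R.sym (translation-difference r s m))
      (const-positive (R.<-respˡ-≈ (R.-‿inverseˡ r) (R.<-respʳ-≈ (R.+-comm _ _) (R.+-monoʳ-< (R.- r) r<s))))

    cancel : ∀ {r s} → translation r <∞ translation s → r R.< s
    cancel {r} {s} lt = R.<-respˡ-≈ (R.+-identityʳ r)
      (R.<-respʳ-≈ (R.trans (R.sym (R.+-assoc _ _ _)) (xyx⁻¹≈y r s))
        (R.+-monoʳ-< r (const-positive⁻¹ _
          (positive-cong (proj₁ (translation s) - proj₁ (translation r)) (const (s R.+ R.- r))
            (translation-difference r s) lt))))

    injective : ∀ {r s} → translation r ≈∞ translation s → r R.≈ s
    injective {r} {s} e = R.trans (R.sym (const-ε r))
      (R.trans (+-cancelˡ _ _ _ (e N.ε)) (const-ε s))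

  ∂-const : ∀ r → ∂ (const r) ≈ 0ₛ
  ∂-const r = Equivalence.from (kernel (const r)) (r , λ m → R.refl)

  ∂-+const : ∀ f r → ∂ (f + const r) ≈ ∂ f
  ∂-+const f r = begin
    ∂ (f + const r)      ≈⟨ ∂.+-homo f (const r) ⟩
    ∂ f + ∂ (const r)    ≈⟨ (λ m → R.+-congˡ (∂-const r m)) ⟩
    ∂ f + 0ₛ             ≈⟨ (λ m → R.+-identityʳ _) ⟩
    ∂ f                  ∎

  -- A nonconstant k has nonzero derivative, so s ↦ k ∘ₛ s is strictly monotone.
  ∘-injective : ∀ k → ¬ Constant k → ∀ s t → k ∘ₛ s ≈ k ∘ₛ t → s ≈∞ t
  ∘-injective k k∉R s t e with em {s ≈∞ t}
  ... | yes s≈t = s≈t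
  ... | no s≉t = ⊥-elim (go (≉⇒<∨> (proj₁ s) (proj₁ t) s≉t)
    (≉⇒<∨> 0ₛ (∂ k) λ 0≈∂k → k∉R (Equivalence.to (kernel k) λ m → R.sym (0≈∂k m))))
    where
    go : s <∞ t ⊎ t <∞ s → ¬ (0ₛ < ∂ k ⊎ ∂ k < 0ₛ)
    go (inj₁ s<t) (inj₁ p) = <⇒≉ (k ∘ₛ s) (k ∘ₛ t) (increasing k k∉R p {s} {t} s<t) e
    go (inj₁ s<t) (inj₂ p) = <⇒≉ (k ∘ₛ t) (k ∘ₛ s) (decreasing k k∉R p {s} {t} s<t) λ m → R.sym (e m)
    go (inj₂ t<s) (inj₁ p) = <⇒≉ (k ∘ₛ t) (k ∘ₛ s) (increasing k k∉R p {t} {s} t<s) λ m → R.sym (e m)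
    go (inj₂ t<s) (inj₂ p) = <⇒≉ (k ∘ₛ s) (k ∘ₛ t) (decreasing k k∉R p {t} {s} t<s) e

  -- If ∂ f is the constant c, then f - c x lies in the kernel of ∂.
  constant-derivative⇒affine : ∀ f → Constant (∂ f) → ∃ λ c → ∃ λ r → f ≈ c · monomial x + const r
  constant-derivative⇒affine f (c , ∂f≈c) = c , r , λ m →
    f-cx≈r⇒f≈cx+r (coeff f m) c (coeff (monomial x) m) (coeff (const r) m) (f-cx≈r m)
    where
    ∂≈0 : ∂ (f + (R.- c) · monomial x) ≈ 0ₛ
    ∂≈0 = begin
      ∂ (f + (R.- c) · monomial x)        ≈⟨ ∂.+-homo f _ ⟩
      ∂ f + ∂ ((R.- c) · monomial x)      ≈⟨ (λ m → R.+-cong (∂f≈c m) (∂.·-homo (R.- c) (monomial x) m)) ⟩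
      const c + (R.- c) · ∂ (monomial x)  ≈⟨ (λ m → R.+-congˡ (R.*-congˡ (D.∂x≈1 m))) ⟩
      const c + (R.- c) · 1ₛ              ≈⟨ (λ m → R.trans (R.+-congˡ (R.sym (-‿distribˡ-* _ _))) (R.-‿inverseʳ _)) ⟩
      0ₛ                                  ∎

    r = proj₁ (Equivalence.to (kernel _) ∂≈0)

    f-cx≈r : f + (R.- c) · monomial x ≈ const r
    f-cx≈r = proj₂ (Equivalence.to (kernel _) ∂≈0)

  module _ {a : R.Carrier} (a≉0 : ¬ a R.≈ 0#) (h : 𝕋∞)
           (h∘τ≈τ∘h : h ⊚ translation a ≈∞ translation a ⊚ h) where

    -- The hypothesis on h reads h ∘ₛ (x + a) ≈ (x + a) ∘ₛ h, and the right side is h + a.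
    h∘[x+a]≈h+a : proj₁ h ∘ₛ translation a ≈ proj₁ h + const a
    h∘[x+a]≈h+a m = R.trans (h∘τ≈τ∘h m) (translation-⊚ a h m)

    ∂[x+a]≈1 : ∂ (proj₁ (translation a)) ≈ 1ₛ
    ∂[x+a]≈1 m = R.trans (∂-+const (monomial x) a m) (D.∂x≈1 m)

    ∂h∘[x+a]≈∂h : ∂ (proj₁ h) ∘ₛ translation a ≈ ∂ (proj₁ h)
    ∂h∘[x+a]≈∂h = begin
      ∂ (proj₁ h) ∘ₛ translation a                                 ≈⟨ unit-* (∂ (proj₁ (translation a))) (∂ (proj₁ h) ∘ₛ translation a) ∂[x+a]≈1 ⟨
      ∂ (proj₁ (translation a)) * (∂ (proj₁ h) ∘ₛ translation a)   ≈⟨ chainRule (proj₁ h) (translation a) ⟨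
      ∂ (proj₁ h ∘ₛ translation a)                                 ≈⟨ ∂.cong h∘[x+a]≈h+a ⟩
      ∂ (proj₁ h + const a)                                        ≈⟨ ∂-+const (proj₁ h) a ⟩
      ∂ (proj₁ h)                                                  ∎

    -- The coefficients at ε differ.
    translation≉x : ¬ translation a ≈∞ x∞
    translation≉x e = a≉0 (R.trans (R.sym (const-ε a)) (+-cancelˡ _ _ _ (R.trans (e N.ε) (R.sym (R.+-identityʳ _)))))

    ∂h-constant : Constant (∂ (proj₁ h))
    ∂h-constant with em {Constant (∂ (proj₁ h))}
    ... | yes p = p
    ... | no ¬p = ⊥-elim (translation≉x (∘-injective (∂ (proj₁ h)) ¬p (translation a) x∞
                    λ m → R.trans (∂h∘[x+a]≈∂h m) (R.sym (C.identityʳ (∂ (proj₁ h)) m))))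

    commuting⇒translation : ∃ λ r → h ≈∞ translation r
    commuting⇒translation with constant-derivative⇒affine (proj₁ h) ∂h-constant
    ... | c , r , h≈cx+r = r , (begin
        proj₁ h                    ≈⟨ h≈cx+r ⟩
        c · monomial x + const r   ≈⟨ (λ m → R.+-congʳ (R.trans (R.*-congʳ c≈1) (*-identityˡ _))) ⟩
        monomial x + const r       ∎)
      where
      module ∘τ = IsStronglyLinear (C.stronglyLinear (translation a))

      c·[x+a]+r≈c·x+r+a : c · proj₁ (translation a) + const r ≈ c · monomial x + const r + const a
      c·[x+a]+r≈c·x+r+a = begin
        c · proj₁ (translation a) + const r       ≈⟨ (λ m → R.+-cong (R.*-congˡ (C.identityˡ (translation a) m)) (const-∘ r (translation a) m)) ⟨
        c · (monomial x ∘ₛ translation a) + (const r ∘ₛ translation a)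
          ≈⟨ (λ m → R.+-congʳ (∘τ.·-homo c (monomial x) m)) ⟨
        ((c · monomial x) ∘ₛ translation a) + (const r ∘ₛ translation a)
          ≈⟨ ∘τ.+-homo (c · monomial x) (const r) ⟨
        (c · monomial x + const r) ∘ₛ translation a  ≈⟨ ∘τ.cong {proj₁ h} {c · monomial x + const r} h≈cx+r ⟨
        proj₁ h ∘ₛ translation a  ≈⟨ h∘[x+a]≈h+a ⟩
        proj₁ h + const a         ≈⟨ (λ m → R.+-congʳ (h≈cx+r m)) ⟩
        c · monomial x + const r + const a ∎

      -- At the monomial ε, where the coefficient of the constant a is a itself.
      c≈1 : c R.≈ 1#
      c≈1 = ca≈a⇒c≈1 (proj₂ (R.inverse (coeff (const a) N.ε) λ z → a≉0 (R.trans (R.sym (const-ε a)) z)))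
              (cx+ca≈cx+a⇒ca≈a c _ _ _ (c·[x+a]+r≈c·x+r+a N.ε))

  translations-commute : ∀ r a → translation r ⊚ translation a ≈∞ translation a ⊚ translation r
  translations-commute r a = begin
    proj₁ (translation r ⊚ translation a)   ≈⟨ translation-homo r a ⟨
    proj₁ (translation (r R.+ a))           ≈⟨ translation-cong (R.+-comm r a) ⟩
    proj₁ (translation (a R.+ r))           ≈⟨ translation-homo a r ⟩
    proj₁ (translation a ⊚ translation r)   ∎

  -- The centralizer of a translation other than x consists of all translations.
  centralizer-translation : ∀ {a} → ¬ a R.≈ 0# → ∀ h →
    h ⊚ translation a ≈∞ translation a ⊚ h ⇔ (∃ λ r → h ≈∞ translation r)
  centralizer-translation {a} a≉0 h = mk⇔ (commuting⇒translation a≉0 h) λ (r , h≈x+r) → begin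
    proj₁ (h ⊚ translation a)               ≈⟨ G.∙-congʳ {translation a} {h} {translation r} h≈x+r ⟩
    proj₁ (translation r ⊚ translation a)   ≈⟨ translations-commute r a ⟩
    proj₁ (translation a ⊚ translation r)   ≈⟨ G.∙-congˡ {translation a} {h} {translation r} h≈x+r ⟨
    proj₁ (translation a ⊚ h)               ∎

  ⊚-monoˡ-< : ∀ k {g h : 𝕋∞} → g <∞ h → k ⊚ g <∞ k ⊚ h
  ⊚-monoˡ-< k {g} {h} = increasing (proj₁ k) (infinite⇒nonconstant k) (∂-pos k) {g} {h}

  ⊚-monoʳ-< : ∀ k {g h : 𝕋∞} → g <∞ h → g ⊚ k <∞ h ⊚ k
  ⊚-monoʳ-< k {g} {h} = C.<-mono k {proj₁ g} {proj₁ h}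

  <∞-resp-≈ : _<∞_ Respects₂ _≈∞_
  <∞-resp-≈ = (λ {f} {g} {h} → proj₁ <-resp-≈ {proj₁ f} {proj₁ g} {proj₁ h}) ,
    (λ {f} {g} {h} → proj₂ <-resp-≈ {proj₁ f} {proj₁ g} {proj₁ h})

  x<x+1 : x∞ <∞ translation 1#
  x<x+1 = positive-cong (const 1#) (monomial x + const 1# - monomial x)
    (λ m → R.sym (xyx⁻¹≈y (coeff (monomial x) m) (coeff (const 1#) m))) (const-positive R.0<1)

  f<x⇒x<f⁻¹ : ∀ f → f <∞ x∞ → x∞ <∞ f G.⁻¹
  f<x⇒x<f⁻¹ f f<x =
    proj₁ <∞-resp-≈ {x∞} {x∞ ⊚ (f G.⁻¹)} {f G.⁻¹} (G.identityˡ (f G.⁻¹))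
      (proj₂ <∞-resp-≈ {x∞ ⊚ (f G.⁻¹)} {f ⊚ (f G.⁻¹)} {x∞} (G.inverseʳ f)
        (⊚-monoʳ-< (f G.⁻¹) {f} {x∞} f<x))

  translation-⁻¹ : ∀ a → translation a G.⁻¹ ≈∞ translation (R.- a)
  translation-⁻¹ a m = R.sym (inverseˡ-unique (translation (R.- a)) (translation a) inverse m)
    where
    open GroupProperties 𝕋∞-group using (inverseˡ-unique)

    inverse : translation (R.- a) ⊚ translation a ≈∞ x∞
    inverse = begin
      proj₁ (translation (R.- a) ⊚ translation a)   ≈⟨ translation-homo (R.- a) a ⟨
      proj₁ (translation (R.- a R.+ a))             ≈⟨ translation-cong (R.-‿inverseˡ a) ⟩
      monomial x + const 0#                         ≈⟨ (λ m → R.trans (R.+-congˡ (R.zeroˡ _)) (R.+-identityʳ _)) ⟩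
      monomial x                                    ∎

  module _ (conjugate : ∀ f g → x∞ <∞ f → x∞ <∞ g → Conjugate 𝕋∞-group f g) where

    conjugate-to-translation : ∀ f → ¬ f ≈∞ x∞ →
      ∃ λ a → ¬ a R.≈ 0# × Conjugate 𝕋∞-group f (translation a)
    conjugate-to-translation f f≉x with ≉⇒<∨> (proj₁ f) (monomial x) f≉x
    ... | inj₂ x<f = 1# , (λ 1≈0 → R.irrefl (R.sym 1≈0) R.0<1) , conjugate f (translation 1#) x<f x<x+1
    ... | inj₁ f<x with conjugate (f G.⁻¹) (translation 1#) (f<x⇒x<f⁻¹ f f<x) x<x+1
    ...   | h , h∘f⁻¹≈[x+1]∘h = R.- 1# ,
      (λ -1≈0 → R.irrefl (R.sym (-‿injective (R.trans -1≈0 (R.sym R.-0≈0)))) R.0<1) ,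
      h , (begin
        proj₁ (h ⊚ f)                         ≈⟨ intertwine-⁻¹ {h} {f} {translation 1#} h∘f⁻¹≈[x+1]∘h ⟩
        proj₁ ((translation 1# G.⁻¹) ⊚ h)     ≈⟨ G.∙-congʳ {h} {translation 1# G.⁻¹} {translation (R.- 1#)} (translation-⁻¹ 1#) ⟩
        proj₁ (translation (R.- 1#) ⊚ h)      ∎)
      where open Conjugation 𝕋∞-group using (intertwine-⁻¹)

    centralizer≅𝐑 : ∀ f → ¬ f ≈∞ x∞ →
      ∃ λ φ → IsOrderedGroupIsomorphism
                (Group.rawGroup (centralizer f)) (_<∞_ on proj₁)
                (Group.rawGroup R.+-group) R._<_ φ
    centralizer≅𝐑 f f≉x =
      let a , a≉0 , h , h∘f≈[x+a]∘h = conjugate-to-translation f f≉x in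
      CentralizerOfConjugate.Isomorphism.centralizer≅ 𝕋∞-group _<∞_ R.+-group R._<_
        ((λ {f} {g} {h} → proj₁ <∞-resp-≈ {f} {g} {h}) , λ {f} {g} {h} → proj₂ <∞-resp-≈ {f} {g} {h})
        (λ k {g} {h} → ⊚-monoˡ-< k {g} {h}) (λ k {g} {h} → ⊚-monoʳ-< k {g} {h})
        translation translation-embedding translation-homo
        {translation a} (centralizer-translation a≉0) {h} {f} h∘f≈[x+a]∘h

proposition4 : ∀ {u : Level} (ℓ : Level) (em : ExcludedMiddle u)
    (𝐑 : OrderedField u) (𝔑 : OrderedAbelianGroup u) →
    let open WellBased ℓ em 𝐑 𝔑 in
    (T : TransserialStructure) →
    let open TransserialStructure T in
    (∀ f g → x∞ <∞ f → x∞ <∞ g → Conjugate 𝕋∞-group f g) →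
    ∀ f → ¬ f ≈∞ x∞ →
    ∃ λ φ → IsOrderedGroupIsomorphism
    (Group.rawGroup (centralizer f)) (_<∞_ on proj₁)
    (Group.rawGroup (OrderedField.+-group 𝐑)) (OrderedField._<_ 𝐑)
    φ
proposition4 ℓ em 𝐑 𝔑 T = Translations.centralizer≅𝐑 ℓ em 𝐑 𝔑 T
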